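{- Let $r\ge 1$ and $s\ge 4$ be fixed integers and let $t=\lfloor (s-3)/2\rfloor$. Then, as $n\to\infty$, \[ F_{r,s}(n)\le \begin{cases} n\cdot 2^{(1/t!)\,\alpha(n)^t+O\left(\alpha(n)^{t-1}\right)}, & s \text{ odd},\\[2pt] n\cdot 2^{(1/t!)\,\alpha(n)^t\log_2\alpha(n)+O\left(\alpha(n)^{t}\right)}, & s \text{ even}, \end{cases} \] where the constants implicit in the $O$-notation depend on $r$ and $s$.
   Context: A sequence $a_1a_2a_3\ldots$ is $r$-sparse if $a_i\ne a_j$ whenever $1\le |i-j|\le r-1$. An $(r,s)$-formation is a concatenation of $s$ permutations of the same set of $r$ distinct symbols. A sequence $S$ contains an $(r,s)$-formation if some (not necessarily contiguous) subsequence of $S$ is an $(r,s)$-formation. A sequence is $(r,s)$-formation-free if it is $r$-sparse and contains no $(r,s)$-formation. $F_{r,s}(n)$ denotes the maximum length of an $(r,s)$-formation-free sequence on $n$ distinct symbols. The inverse Ackermann hierarchy is defined by $\alpha_1(x)=\lceil x/2\rceil$ and, for $k\ge 2$, $\alpha_k(x)=0$ if $x\le 1$ and $\alpha_k(x)=1+\alpha_k(\alpha_{k-1}(x))$ otherwise. The inverse Ackermann function is $\alpha(x)=\min\{k\mid\alpha_k(x)\le 3\}$. -}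

module Defs where

open import Data.Nat using (ℕ; zero; suc; _+_; _*_; _∸_; _^_; _≤_; _<_; _≤?_; ⌈_/2⌉; ⌊_/2⌋; _!)
open import Data.Fin using (Fin; toℕ)
open import Data.List using (List; length; lookup; concat)
open import Data.List.Relation.Unary.All using (All)
open import Data.List.Relation.Unary.Unique.Propositional using (Unique)
open import Data.List.Relation.Binary.Permutation.Propositional using (_↭_)
open import Data.List.Relation.Binary.Sublist.Propositional using (_⊆_)
open import Data.Product using (Σ; _×_; ∃-syntax)
open import Relation.Binary.PropositionalEquality using (_≡_; _≢_)
open import Relation.Nullary using (¬_; yes; no)

Sparse : ∀ {n} → ℕ → List (Fin n) → Set
Sparse r S = ∀ (i j : Fin (length S)) → toℕ i < toℕ j → toℕ j < toℕ i + r →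
  lookup S i ≢ lookup S j

ContainsFormation : ∀ {n} → ℕ → ℕ → List (Fin n) → Set
ContainsFormation {n} r s S =
  ∃[ X ] (length X ≡ r × Unique X ×
    ∃[ Ps ] (length Ps ≡ s × All (_↭ X) Ps × concat Ps ⊆ S))

FormationFree : ∀ {n} → ℕ → ℕ → List (Fin n) → Set
FormationFree r s S = Sparse r S × ¬ ContainsFormation r s S

-- count f x = 0 if x ≤ 1, else 1 + count f (f x); fuel bounds the recursion.
-- (For the α_k below, f x < x whenever x ≥ 2, so fuel x is never exhausted.)
iterCount : (ℕ → ℕ) → ℕ → ℕ → ℕ
iterCount f zero x = zero
iterCount f (suc fuel) x with x ≤? 1
... | yes _ = zero
... | no _ = suc (iterCount f fuel (f x))

-- α_k(x) (paper indexing, k ≥ 1; k = 0 is unused).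
alphaK : ℕ → ℕ → ℕ
alphaK zero x = zero
alphaK (suc zero) x = ⌈ x /2⌉
alphaK (suc (suc k)) x = iterCount (alphaK (suc k)) x x

-- α(x) = min { k ≥ 1 | α_k(x) ≤ 3 }, found by linear search from k = 1
-- (fuel x + 4 is more than enough).
alphaSearch : ℕ → ℕ → ℕ → ℕ
alphaSearch zero k x = k
alphaSearch (suc fuel) k x with alphaK k x ≤? 3
... | yes _ = k
... | no _ = alphaSearch fuel (suc k) x

alpha : ℕ → ℕ
alpha x = alphaSearch (x + 4) 1 x

{-# OPTIONS --safe #-}
module Submission where

-- A symbol that lives in at least two of a number of groups of consecutive blocks is, inside the first of them,
-- followed by one more occurrence outside, inside the last one preceded by one, and inside the others both.  So the
-- symbols with many occurrences in their first, last or some other group obey the bounds for s - 1, s - 1 and s - 2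
-- permutations, and all remaining symbols are spread over many groups and survive when each group is contracted to a
-- block.  Let Π be the maximal number of symbols occurring more than k times each in m blocks.  The resulting
-- recurrence, with groups of size a power of the previous inverse Ackermann function, shows by induction on the
-- level d that Π is at most m times a power of α_d(m) as soon as k is at least R_s(d), where
-- R_s(d) = R_{s-2}(d) R_s(d-1) + 2 R_{s-1}(d); this product formula is the source of the exponent α^t / t!.
-- A sequence is reduced to O(n) blocks by cutting it at the first and last occurrences of all symbols: what lies
-- between two cuts contains no (r, s-2)-formation.  Taking d = α(n) makes α_d(m) bounded.

open import Defs
open import Data.Bool using (Bool; true; false; T; _∧_; T?)
open import Data.Bool.Properties using (T-∧)
open import Data.Empty using (⊥-elim)
open import Data.Fin using (Fin; toℕ)
import Data.Fin
open import Data.List using (List; []; _∷_; _++_; length; concat; map; filter; take; drop; lookup; [_]; allFin)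
open import Data.List.Membership.Propositional using (_∈_; _∉_)
open import Data.List.Membership.Propositional.Properties using (∈-++⁺ˡ; ∈-++⁺ʳ; ∈-++⁻; ∈-filter⁺; ∈-∃++; ∈-allFin)
import Data.List.Membership.DecPropositional as DecMembership
open import Data.List.Properties using (∷-injective; ++-assoc; ++-identityʳ; concat-++; length-++; length-map; length-take; length-drop; length-tabulate; map-++; take++drop≡id)
open import Data.List.Relation.Binary.Permutation.Propositional using (_↭_; ↭-refl; ↭-sym; ↭-trans; prep)
open import Data.List.Relation.Binary.Permutation.Propositional.Properties using (shift; All-resp-↭)
open import Data.List.Relation.Binary.Sublist.Propositional using (_⊆_; []; _∷ʳ_; _∷_; ⊆-trans; minimum)
open import Data.List.Relation.Binary.Sublist.Propositional.Properties using (All-resp-⊆; filter-⊆; ++⁺; take-⊆)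
open import Data.List.Relation.Unary.All using (All; []; _∷_)
import Data.List.Relation.Unary.All as All
import Data.List.Relation.Unary.All.Properties as Allₚ
open import Data.List.Relation.Unary.AllPairs using ([]; _∷_)
open import Data.List.Relation.Unary.Any using (Any; here; there)
open import Data.List.Relation.Unary.Unique.Propositional using (Unique)
import Data.List.Relation.Unary.Unique.Propositional.Properties as Uniqueₚ
open import Data.Nat using (ℕ; zero; suc; NonZero; >-nonZero; _+_; _*_; _∸_; _^_; _≤_; _<_; _⊓_; _⊔_; _<ᵇ_; _≤ᵇ_; _≤?_; _/_; _%_; _≤′_; ≤′-refl; ≤′-step; z≤n; s≤s; ⌈_/2⌉; ⌊_/2⌋; _!)
open import Data.Nat.DivMod using (m≡m%n+[m/n]*n; m%n<n; m/n*n≤m)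
open import Data.Nat.ListAction using (sum)
open import Data.Nat.Properties
open import Data.Nat.Tactic.RingSolver using (solve-∀)
open import Data.Product using (_×_; _,_; ∃-syntax; proj₁; proj₂)
open import Data.Sum using (_⊎_; inj₁; inj₂)
open import Data.Unit using (⊤; tt)
open import Function using (_∘_; id; Equivalence)
open import Relation.Binary.Definitions using (DecidableEquality)
open import Relation.Binary.PropositionalEquality using (_≡_; _≢_; refl; sym; trans; cong; cong₂; subst; module ≡-Reasoning)
open import Relation.Nullary using (¬_; Dec; yes; no; does; ¬?)

-- Sequences of blocks

-- The recurrence counts frequent symbols, the theorem counts letters. Passing from one to the other
-- costs a factor k + 1, and with k = R_s(d) this factor is the main term; the bound for s - 2
-- permutations on the stretches between cuts enters as one more factor, which fits into the error
-- term. The weight w, the factor in front of m, is an obstacle: in general it grows like 2 ^ O(d).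
-- The error terms tolerate this from s = 6 on, but for s = 4 and s = 5 they leave room for a
-- constant only, so there further grouping moves the weight into the multiplicity, which grows by a
-- constant factor. Neither 1 / t! nor logarithms are needed: everything is raised to the power t!,
-- and α ^ (α ^ t) stands for 2 ^ (α ^ t log₂ α).

bit : Bool → ℕ
bit false = 0
bit true  = 1

count : {A : Set} → (A → Bool) → List A → ℕ
count p []       = 0
count p (x ∷ xs) = bit (p x) + count p xs

count-++ : {A : Set} (p : A → Bool) (xs ys : List A) → count p (xs ++ ys) ≡ count p xs + count p ys
count-++ p []       ys = refl
count-++ p (x ∷ xs) ys = trans (cong (bit (p x) +_) (count-++ p xs ys)) (sym (+-assoc (bit (p x)) _ _))

bit≤1 : ∀ b → bit b ≤ 1
bit≤1 false = z≤n
bit≤1 true  = ≤-refl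

T⇒0<bit : ∀ {b} → T b → 0 < bit b
T⇒0<bit {true} _ = s≤s z≤n

count≤length : {A : Set} (p : A → Bool) (xs : List A) → count p xs ≤ length xs
count≤length p []       = z≤n
count≤length p (x ∷ xs) = +-mono-≤ (bit≤1 (p x)) (count≤length p xs)

count≡length-filter : {A : Set} (p : A → Bool) (xs : List A) → count p xs ≡ length (filter (T? ∘ p) xs)
count≡length-filter p [] = refl
count≡length-filter p (x ∷ xs) with p x
... | true  = cong suc (count≡length-filter p xs)
... | false = count≡length-filter p xs

sum-+ : {A : Set} (f g : A → ℕ) (xs : List A) → sum (map (λ x → f x + g x) xs) ≡ sum (map f xs) + sum (map g xs)
sum-+ f g []       = refl
sum-+ f g (x ∷ xs) = trans (cong (f x + g x +_) (sum-+ f g xs)) (lem (f x) (g x) _ _)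
  where
  lem : ∀ a b c d → a + b + (c + d) ≡ a + c + (b + d)
  lem = solve-∀

double-count : {A E : Set} (inc : E → A → Bool) (B : List E) (Us : List A) →
  sum (map (λ e → count (inc e) Us) B) ≡ sum (map (λ x → count (λ e → inc e x) B) Us)
double-count inc [] Us = sym (zeros Us)
  where
  zeros : ∀ Us → sum (map (λ x → 0) Us) ≡ 0
  zeros []       = refl
  zeros (_ ∷ Us) = zeros Us
double-count inc (e ∷ B) Us = trans (cong₂ _+_ (lem Us) (double-count inc B Us)) (sym (sum-+ _ _ Us))
  where
  lem : ∀ Us → count (inc e) Us ≡ sum (map (λ x → bit (inc e x)) Us)
  lem []       = refl
  lem (x ∷ Us) = cong (bit (inc e x) +_) (lem Us)

sum≥length : {A : Set} (f : A → ℕ) (xs : List A) → All (λ x → 1 ≤ f x) xs → length xs ≤ sum (map f xs)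
sum≥length f [] [] = z≤n
sum≥length f (x ∷ xs) (h ∷ hs) = +-mono-≤ h (sum≥length f xs hs)

Any⇒1≤count : {A : Set} {p : A → Bool} {xs : List A} → Any (T ∘ p) xs → 1 ≤ count p xs
Any⇒1≤count (here t)  = ≤-trans (T⇒0<bit t) (m≤m+n _ _)
Any⇒1≤count (there a) = ≤-trans (Any⇒1≤count a) (m≤n+m _ _)

covering-bound : {A : Set} (ps : List (A → Bool)) (Us : List A) →
  All (λ x → Any (λ p → T (p x)) ps) Us → length Us ≤ sum (map (λ p → count p Us) ps)
covering-bound ps Us h =
  ≤-trans (sum≥length _ Us (All.map Any⇒1≤count h)) (≤-reflexive (sym (double-count id ps Us)))

module Blocks {A E : Set} (inc : E → A → Bool) where

  occ : List E → A → ℕ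
  occ B x = count (λ e → inc e x) B

  occ-++ : ∀ B C x → occ (B ++ C) x ≡ occ B x + occ C x
  occ-++ B C x = count-++ (λ e → inc e x) B C

  -- The order of symbols inside a block is ignored: the cuts between consecutive permutations
  -- are only allowed at block boundaries.  This makes formations rarer, and hence the upper bounds stronger.
  Formation : ℕ → List E → List A → Set
  Formation zero    B X = ⊤
  Formation (suc s) B X =
    ∃[ B₁ ] ∃[ B₂ ] (B ≡ B₁ ++ B₂ × All (λ x → 0 < occ B₁ x) X × Formation s B₂ X)

  -- A cap on the number of symbols instead of the absence of r of them, so that it directly counts
  -- a filtered list of symbols. Formations on exactly r symbols remain allowed, which only weakens
  -- the hypothesis.
  Free : ℕ → ℕ → List E → List A → Set
  Free r s B Us = ∀ {X} → X ⊆ Us → Formation s B X → length X ≤ r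

  occurs-++ˡ : ∀ B C {x} → 0 < occ B x → 0 < occ (B ++ C) x
  occurs-++ˡ B C {x} h = ≤-trans h (≤-trans (m≤m+n _ _) (≤-reflexive (sym (occ-++ B C x))))

  occurs-++ʳ : ∀ B C {x} → 0 < occ C x → 0 < occ (B ++ C) x
  occurs-++ʳ B C {x} h = ≤-trans h (≤-trans (m≤n+m _ (occ B x)) (≤-reflexive (sym (occ-++ B C x))))

  formation-prepend : ∀ s P {B X} → Formation s B X → Formation s (P ++ B) X
  formation-prepend zero    P f = tt
  formation-prepend (suc s) P (B₁ , B₂ , refl , h , f) =
    P ++ B₁ , B₂ , sym (++-assoc P B₁ B₂) , All.map (occurs-++ʳ P B₁) h , f

  formation-append : ∀ s {B} Q {X} → Formation s B X → Formation s (B ++ Q) X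
  formation-append zero    Q f = tt
  formation-append (suc s) Q (B₁ , B₂ , refl , h , f) =
    B₁ , B₂ ++ Q , ++-assoc B₁ B₂ Q , h , formation-append s Q f

  formation-cons : ∀ s P {B X} → All (λ x → 0 < occ P x) X → Formation s B X → Formation (suc s) (P ++ B) X
  formation-cons s P h f = P , _ , refl , h , f

  formation-snoc : ∀ s {B} Q {X} → All (λ x → 0 < occ Q x) X → Formation s B X → Formation (suc s) (B ++ Q) X
  formation-snoc zero    {B} Q h f = B ++ Q , [] , sym (++-identityʳ _) , All.map (occurs-++ʳ B Q) h , tt
  formation-snoc (suc s) Q h (B₁ , B₂ , refl , h₁ , f) =
    B₁ , B₂ ++ Q , ++-assoc B₁ B₂ Q , h₁ , formation-snoc s Q h f

  -- A group of blocks acts as a block again, with `List E` in place of `E`; hence `Bounded`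
  -- quantifies over the type of blocks.
  merged : List E → A → Bool
  merged g x = 0 <ᵇ occ g x

open Blocks

formation-concat : {A E : Set} (inc : E → A → Bool) (s : ℕ) {gs : List (List E)} {X : List A} →
  Formation (merged inc) s gs X → Formation inc s (concat gs) X
formation-concat inc zero    f = tt
formation-concat inc (suc s) {X = X} (gs₁ , gs₂ , refl , h , f) =
  concat gs₁ , concat gs₂ , sym (concat-++ gs₁ gs₂) , All.map (occ-concat gs₁) h , formation-concat inc s f
  where
  occ-concat : ∀ gs {x} → 0 < occ (merged inc) gs x → 0 < occ inc (concat gs) x
  occ-concat (g ∷ gs) {x} h with occ inc g x in eq
  ... | zero  = occurs-++ʳ inc g (concat gs) (occ-concat gs h)
  ... | suc n = occurs-++ˡ inc g (concat gs) (subst (0 <_) (sym eq) (s≤s z≤n))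

-- The statement "Π ≤ w (m - 1) for all m ≤ M" for the maximal number Π of symbols in a formation-free
-- sequence of m blocks in which each symbol occurs more than k times.
record Bounded (r k s w M : ℕ) : Set₁ where
  constructor bounded
  field
    symbols≤ : ∀ {A E : Set} (inc : E → A → Bool) (B : List E) (Us : List A) →
      length B ≤ M → All (λ x → k < occ inc B x) Us → Free inc r s B Us → length Us ≤ w * (length B ∸ 1)

open Bounded

bounded-mono : ∀ {r k k′ s w w′ M M′} → k ≤ k′ → w ≤ w′ → M′ ≤ M → Bounded r k s w M → Bounded r k′ s w′ M′
bounded-mono k≤ w≤ M≤ h = bounded λ inc B Us l a f →
  ≤-trans (symbols≤ h inc B Us (≤-trans l M≤) (All.map (≤-<-trans k≤) a) f) (*-monoˡ-≤ (length B ∸ 1) w≤)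

bounded-vanish : ∀ {r k s M} → M ≤ k → Bounded r k s 0 M
bounded-vanish M≤k = bounded λ where
  inc B []       l a       f → z≤n
  inc B (x ∷ Us) l (h ∷ a) f → ⊥-elim (<-irrefl refl (<-≤-trans h (≤-trans (count≤length _ B) (≤-trans l M≤k))))

filter-bound : ∀ {r k s w M} → Bounded r k s w M → {A E : Set} (inc : E → A → Bool) (g : List E) (Us : List A)
  (p : A → Bool) → length g ≤ M → (∀ {x} → T (p x) → k < occ inc g x) →
  (∀ {X} → X ⊆ Us → All (T ∘ p) X → Formation inc s g X → length X ≤ r) →
  count p Us ≤ w * (length g ∸ 1)
filter-bound h inc g Us p l many free =
  ≤-trans (≤-reflexive (count≡length-filter p Us))
    (symbols≤ h inc g _ l (All.map many (Allₚ.all-filter (T? ∘ p) Us))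
      (λ X⊆ f → free (⊆-trans X⊆ (filter-⊆ (T? ∘ p) Us)) (All-resp-⊆ X⊆ (Allₚ.all-filter (T? ∘ p) Us)) f))

T-∧⁻ : ∀ {a b} → T (a ∧ b) → T a × T b
T-∧⁻ = Equivalence.to T-∧

T-∧⁺ : ∀ {a b} → T a → T b → T (a ∧ b)
T-∧⁺ p q = Equivalence.from T-∧ (p , q)

-- The recurrence over groups of blocks

module Recurrence {A E : Set} (inc : E → A → Bool) (k k₁ k₂ : ℕ) where

  private
    o : List E → A → ℕ
    o = occ inc

  -- The classes may overlap, and `local` does not ask whether the symbol also occurs elsewhere:
  -- only the sum of the class sizes is bounded, so covering the symbols is enough.
  local starting ending middle : (pre g post : List E) → A → Bool
  local    pre g post x = k <ᵇ o g x
  starting pre g post x = (k₁ <ᵇ o g x) ∧ (0 <ᵇ o post x)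
  ending   pre g post x = (k₁ <ᵇ o g x) ∧ (0 <ᵇ o pre x)
  middle   pre g post x = (k₂ <ᵇ o g x) ∧ ((0 <ᵇ o pre x) ∧ (0 <ᵇ o post x))

  classes : List E → List (List E) → List (A → Bool)
  classes pre [] = []
  classes pre (g ∷ gs) =
    local pre g (concat gs) ∷ starting pre g (concat gs) ∷ ending pre g (concat gs) ∷ middle pre g (concat gs) ∷
    classes (pre ++ g) gs

  Hit : List E → List (List E) → A → Set
  Hit pre gs x = Any (λ p → T (p x)) (classes pre gs)

  skip : ∀ {pre g gs x} → Hit (pre ++ g) gs x → Hit pre (g ∷ gs) x
  skip h = there (there (there (there h)))

  -- Once x has been seen, a group meeting x is either its last, with at most k₁ occurrences, or a
  -- middle one, with at most k₂; any excess puts x into a class.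
  hit-or-few-after : ∀ pre gs x → 0 < o pre x →
    Hit pre gs x ⊎ o (concat gs) x ≤ k₁ + k₂ * occ (merged inc) gs x
  hit-or-few-after pre [] x hp = inj₂ z≤n
  hit-or-few-after pre (g ∷ gs) x hp with hit-or-few-after (pre ++ g) gs x (occurs-++ˡ inc pre g hp)
  ... | inj₁ h = inj₁ (skip {pre} {g} {gs} h)
  ... | inj₂ ih rewrite occ-++ inc g (concat gs) x with o g x in eg
  ...   | zero  = inj₂ ih
  ...   | suc n with o (concat gs) x in ec
  ...     | zero with suc n ≤? k₁
  ...       | yes q = inj₂ (≤-trans (≤-reflexive (+-identityʳ _)) (≤-trans q (m≤m+n _ _)))
  ...       | no ¬q = inj₁ (there (there (here (T-∧⁺ (subst (λ z → T (k₁ <ᵇ z)) (sym eg) (<⇒<ᵇ (≰⇒> ¬q))) (<⇒<ᵇ hp)))))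
  hit-or-few-after pre (g ∷ gs) x hp | inj₂ ih | suc n | suc m with suc n ≤? k₂
  ... | yes q = inj₂ (≤-trans (+-mono-≤ q ih) (≤-reflexive (lem k₁ k₂ _)))
    where
    lem : ∀ a b c → b + (a + b * c) ≡ a + b * (1 + c)
    lem = solve-∀
  ... | no ¬q = inj₁ (there (there (there (here
      (T-∧⁺ (subst (λ z → T (k₂ <ᵇ z)) (sym eg) (<⇒<ᵇ (≰⇒> ¬q)))
        (T-∧⁺ (<⇒<ᵇ hp) (subst (λ z → T (0 <ᵇ z)) (sym ec) tt)))))))

  -- Either x lives in a single group, or its first group adds another k₁ to the previous bound. The
  -- last alternative dictates the condition on k in `recurrence`.
  hit-or-few : ∀ pre gs x →
    Hit pre gs x ⊎ (o (concat gs) x ≤ k ⊎ o (concat gs) x ≤ k₁ + (k₁ + k₂ * occ (merged inc) gs x))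
  hit-or-few pre [] x = inj₂ (inj₁ z≤n)
  hit-or-few pre (g ∷ gs) x with o g x in eg
  hit-or-few pre (g ∷ gs) x | zero with hit-or-few (pre ++ g) gs x
  ... | inj₁ h = inj₁ (skip {pre} {g} {gs} h)
  ... | inj₂ ih rewrite occ-++ inc g (concat gs) x | eg = inj₂ ih
  hit-or-few pre (g ∷ gs) x | suc n with o (concat gs) x in ec
  hit-or-few pre (g ∷ gs) x | suc n | zero with suc n ≤? k
  ... | yes q rewrite occ-++ inc g (concat gs) x | eg | ec = inj₂ (inj₁ (≤-trans (≤-reflexive (+-identityʳ _)) q))
  ... | no ¬q = inj₁ (here (subst (λ z → T (k <ᵇ z)) (sym eg) (<⇒<ᵇ (≰⇒> ¬q))))
  hit-or-few pre (g ∷ gs) x | suc n | suc m with suc n ≤? k₁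
  ... | no ¬q = inj₁ (there (here (T-∧⁺ (subst (λ z → T (k₁ <ᵇ z)) (sym eg) (<⇒<ᵇ (≰⇒> ¬q)))
                  (subst (λ z → T (0 <ᵇ z)) (sym ec) tt))))
  ... | yes q with hit-or-few-after (pre ++ g) gs x (occurs-++ʳ inc pre g (subst (0 <_) (sym eg) (s≤s z≤n)))
  ...   | inj₁ h = inj₁ (skip {pre} {g} {gs} h)
  ...   | inj₂ ih rewrite occ-++ inc g (concat gs) x | eg =
    inj₂ (inj₂ (+-mono-≤ q (≤-trans ih (+-monoʳ-≤ k₁ (*-monoʳ-≤ k₂ (n≤1+n _))))))

  -- A later occurrence of each of the symbols adds one permutation to a formation inside a group, and so does
  -- an earlier one.
  classes-bound : ∀ {r s w₀ w₁ w₂ M} (Us : List A) {B : List E} →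
    Bounded r k (suc (suc s)) w₀ M → Bounded r k₁ (suc s) w₁ M → Bounded r k₂ s w₂ M →
    Free inc r (suc (suc s)) B Us → ∀ pre gs → B ≡ pre ++ concat gs → All (λ g → length g ≤ M) gs →
    sum (map (λ p → count p Us) (classes pre gs)) ≤ (w₀ + 2 * w₁ + w₂) * sum (map (λ g → length g ∸ 1) gs)
  classes-bound Us b₀ b₁ b₂ free pre [] eq [] = z≤n
  classes-bound {s = s} {w₀} {w₁} {w₂} Us b₀ b₁ b₂ free pre (g ∷ gs) refl (l ∷ ls) =
    ≤-trans (+-mono-≤ c₀ (+-mono-≤ c₁ (+-mono-≤ c₁′ (+-mono-≤ c₂
      (classes-bound Us b₀ b₁ b₂ free (pre ++ g) gs (sym (++-assoc pre g (concat gs))) ls)))))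
      (≤-reflexive (lem w₀ w₁ w₂ (length g ∸ 1) (sum (map (λ g → length g ∸ 1) gs))))
    where
    post = concat gs
    c₀ = filter-bound b₀ inc g Us (local pre g post) l (<ᵇ⇒< _ _)
           (λ X⊆ a f → free X⊆ (formation-prepend inc (2 + s) pre (formation-append inc (2 + s) post f)))
    c₁ = filter-bound b₁ inc g Us (starting pre g post) l (<ᵇ⇒< _ _ ∘ proj₁ ∘ T-∧⁻)
           (λ X⊆ a f → free X⊆ (formation-prepend inc (2 + s) pre
             (formation-snoc inc (1 + s) post (All.map (λ {x} → <ᵇ⇒< 0 (o post x) ∘ proj₂ ∘ T-∧⁻) a) f)))
    c₁′ = filter-bound b₁ inc g Us (ending pre g post) l (<ᵇ⇒< _ _ ∘ proj₁ ∘ T-∧⁻)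
           (λ X⊆ a f → free X⊆ (formation-cons inc (1 + s) pre (All.map (λ {x} → <ᵇ⇒< 0 (o pre x) ∘ proj₂ ∘ T-∧⁻) a)
             (formation-append inc (1 + s) post f)))
    c₂ = filter-bound b₂ inc g Us (middle pre g post) l (<ᵇ⇒< _ _ ∘ proj₁ ∘ T-∧⁻)
           (λ X⊆ a f → free X⊆ (formation-cons inc (1 + s) pre
             (All.map (λ {x} t → <ᵇ⇒< 0 (o pre x) (proj₁ (T-∧⁻ (proj₂ (T-∧⁻ {k₂ <ᵇ o g x} t))))) a)
             (formation-snoc inc s post
               (All.map (λ {x} t → <ᵇ⇒< 0 (o post x) (proj₂ (T-∧⁻ {0 <ᵇ o pre x} (proj₂ (T-∧⁻ {k₂ <ᵇ o g x} t))))) a) f)))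
    lem : ∀ a b c m n → a * m + (b * m + (b * m + (c * m + (a + 2 * b + c) * n))) ≡ (a + 2 * b + c) * (m + n)
    lem = solve-∀

∸1-superadd : ∀ m n → (m ∸ 1) + (n ∸ 1) ≤ (m + n) ∸ 1
∸1-superadd zero    n = ≤-refl
∸1-superadd (suc m) n = +-monoʳ-≤ m (m∸n≤m n 1)

sum-pred≤ : {E : Set} (gs : List (List E)) → sum (map (λ g → length g ∸ 1) gs) ≤ length (concat gs) ∸ 1
sum-pred≤ [] = z≤n
sum-pred≤ (g ∷ gs) = ≤-trans (+-monoʳ-≤ (length g ∸ 1) (sum-pred≤ gs))
  (≤-trans (∸1-superadd (length g) _) (≤-reflexive (cong (_∸ 1) (sym (length-++ g)))))

-- The reason for bounds in m - 1: they survive grouping without rounding losses. Although the last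
-- group may be short, one less than the number of groups, times t, is still at most m - 1.
chunks : {E : Set} (t : ℕ) → 1 ≤ t → (B : List E) → ∃[ gs ] (concat gs ≡ B × All (λ g → length g ≤ t) gs ×
  (length gs ∸ 1) * t ≤ length B ∸ 1)
chunks {E} t 1≤t B = go (length B) B ≤-refl
  where
  go : ∀ n (B : List E) → length B ≤ n → ∃[ gs ] (concat gs ≡ B × All (λ g → length g ≤ t) gs ×
    (length gs ∸ 1) * t ≤ length B ∸ 1)
  go zero [] l = [] , refl , [] , z≤n
  go (suc n) B l with length B ≤? t
  ... | yes p = B ∷ [] , ++-identityʳ B , p ∷ [] , z≤n
  ... | no ¬p with go n (drop t B) (≤-trans (≤-reflexive (length-drop t B))
                    (≤-trans (∸-monoʳ-≤ (length B) 1≤t) (∸-monoˡ-≤ 1 l)))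
  ...   | gs , eq , al , q = take t B ∷ gs , trans (cong (take t B ++_) eq) (take++drop≡id t B) ,
          ≤-trans (≤-reflexive (length-take t B)) (m⊓n≤m t _) ∷ al ,
          bound (length gs) (≤-trans q (≤-reflexive (cong (_∸ 1) (length-drop t B))))
    where
    open ≤-Reasoning
    t<B = ≰⇒> ¬p
    bound : ∀ l → (l ∸ 1) * t ≤ length B ∸ t ∸ 1 → l * t ≤ length B ∸ 1
    bound zero    h = z≤n
    bound (suc l) h = begin
      t + l * t                 ≤⟨ +-monoʳ-≤ t h ⟩
      t + (length B ∸ t ∸ 1)    ≡⟨ cong (t +_) (trans (∸-+-assoc (length B) t 1) (trans (cong (length B ∸_) (+-comm t 1)) (sym (∸-+-assoc (length B) 1 t)))) ⟩
      t + (length B ∸ 1 ∸ t)    ≡⟨ m+[n∸m]≡n (∸-monoˡ-≤ 1 t<B) ⟩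
      length B ∸ 1 ∎

lengths≤concat : {E : Set} (gs : List (List E)) → All (λ g → length g ≤ length (concat gs)) gs
lengths≤concat [] = []
lengths≤concat (g ∷ gs) =
  ≤-trans (m≤m+n _ _) (≤-reflexive (sym (length-++ g))) ∷
  All.map (λ h → ≤-trans h (≤-trans (m≤n+m _ (length g)) (≤-reflexive (sym (length-++ g))))) (lengths≤concat gs)

-- Q caps the number of groups. The weight `w₃ * t` of the contracted sequence contributes only
-- `w₃`, because each of its blocks stands for t blocks. As t may exceed M, bounds inside the groups
-- are asked for up to `t ⊓ M` only.
recurrence : ∀ {r k k₁ k₂ k₃ s w₀ w₁ w₂ w₃ M} t Q → 1 ≤ t → M ≤ Q * t → k₁ + (k₁ + k₂ * k₃) ≤ k →
  Bounded r k (2 + s) w₀ (t ⊓ M) → Bounded r k₁ (1 + s) w₁ (t ⊓ M) → Bounded r k₂ s w₂ (t ⊓ M) →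
  Bounded r k₃ (2 + s) (w₃ * t) Q → Bounded r k (2 + s) (w₀ + 2 * w₁ + w₂ + w₃) M
recurrence {r} {k} {k₁} {k₂} {k₃} {s} {w₀} {w₁} {w₂} {w₃} {M} t Q 1≤t M≤ k≥ b₀ b₁ b₂ b₃ = bounded go
  where
  go : ∀ {A E : Set} (inc : E → A → Bool) (B : List E) (Us : List A) → length B ≤ M →
    All (λ x → k < occ inc B x) Us → Free inc r (2 + s) B Us → length Us ≤ (w₀ + 2 * w₁ + w₂ + w₃) * (length B ∸ 1)
  go inc B Us l many free with 1 ≤? length B
  ... | no empty = ≤-trans (symbols≤ (bounded-vanish (≤-pred (≰⇒> empty))) inc B Us ≤-refl (All.map (≤-<-trans z≤n) many) free) z≤n
  ... | yes nonempty with chunks t 1≤t B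
  ...   | gs , refl , small , few = begin
    length Us
      ≤⟨ covering-bound (spread ∷ classes [] gs) Us (All.map hits many) ⟩
    count spread Us + sum (map (λ p → count p Us) (classes [] gs))
      ≤⟨ +-mono-≤ spread-bound (classes-bound Us b₀ b₁ b₂ free [] gs refl small′) ⟩
    w₃ * t * (length gs ∸ 1) + W * sum (map (λ g → length g ∸ 1) gs)
      ≤⟨ +-mono-≤ (≤-trans (≤-reflexive (lem w₃ t _)) (*-monoʳ-≤ w₃ few)) (*-monoʳ-≤ W (sum-pred≤ gs)) ⟩
    w₃ * (length B ∸ 1) + W * (length B ∸ 1)
      ≡⟨ trans (+-comm (w₃ * (length B ∸ 1)) _) (sym (*-distribʳ-+ (length B ∸ 1) W w₃)) ⟩
    (W + w₃) * (length B ∸ 1) ∎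
    where
    open ≤-Reasoning
    open Recurrence inc k k₁ k₂
    W = w₀ + 2 * w₁ + w₂
    lem : ∀ a b c → a * b * c ≡ a * (c * b)
    lem = solve-∀
    spread : _ → Bool
    spread x = k₃ <ᵇ occ (merged inc) gs x
    hits : ∀ {x} → k < occ inc (concat gs) x → Any (λ p → T (p x)) (spread ∷ classes [] gs)
    hits {x} h with occ (merged inc) gs x ≤? k₃
    ... | no ¬p = here (<⇒<ᵇ (≰⇒> ¬p))
    ... | yes p with hit-or-few [] gs x
    ...   | inj₁ hit = there hit
    ...   | inj₂ (inj₁ q) = ⊥-elim (<-irrefl refl (<-≤-trans h q))
    ...   | inj₂ (inj₂ q) = ⊥-elim (<-irrefl refl (<-≤-trans h (≤-trans q
              (≤-trans (+-monoʳ-≤ k₁ (+-monoʳ-≤ k₁ (*-monoʳ-≤ k₂ p))) k≥))))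
    groups≤Q : length gs ≤ Q
    groups≤Q = ≤-trans (m≤n+m∸n (length gs) 1) (*-cancelʳ-< t (length gs ∸ 1) Q
      (<-≤-trans (≤-<-trans few (∸-monoʳ-< {length B} {1} {0} (s≤s z≤n) nonempty)) (≤-trans l M≤)))
    spread-bound : count spread Us ≤ w₃ * t * (length gs ∸ 1)
    spread-bound = filter-bound b₃ (merged inc) gs Us spread groups≤Q (<ᵇ⇒< _ _)
      (λ X⊆ a f → free X⊆ (formation-concat inc (2 + s) f))
    small′ : All (λ g → length g ≤ t ⊓ M) gs
    small′ = All.zipWith (λ { (p , q) → ⊓-glb p (≤-trans q l) }) (small , lengths≤concat gs)

-- Bounds along the Ackermann hierarchy

-- Each symbol is charged to the block of its second occurrence. The symbols charged to one block
-- occur before it, in it and at least i times after it, so freeness leaves at most r of them. The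
-- first block is never charged, whence m - 1.
module Base {A E : Set} (inc : E → A → Bool) (i : ℕ) where

  through : List E → E → List E → A → Bool
  through pre e es x = (0 <ᵇ occ inc pre x) ∧ ((0 <ᵇ bit (inc e x)) ∧ (i ≤ᵇ occ inc es x))

  throughs : List E → List E → List (A → Bool)
  throughs pre []       = []
  throughs pre (e ∷ es) = through pre e es ∷ throughs (pre ++ [ e ]) es

  hit-after : ∀ pre es x → 0 < occ inc pre x → suc i ≤ occ inc es x → Any (λ p → T (p x)) (throughs pre es)
  hit-after pre (e ∷ es) x hp h with inc e x in eq
  ... | true  = here (T-∧⁺ (<⇒<ᵇ hp) (T-∧⁺ (subst (λ z → T (0 <ᵇ bit z)) (sym eq) tt) (≤⇒≤ᵇ (≤-pred h))))
  ... | false = there (hit-after (pre ++ [ e ]) es x (occurs-++ˡ inc pre [ e ] hp) h)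

  hit : ∀ pre es x → suc (suc i) ≤ occ inc es x → Any (λ p → T (p x)) (throughs pre es)
  hit pre (e ∷ es) x h with inc e x in eq
  ... | true  = there (hit-after (pre ++ [ e ]) es x
                  (occurs-++ʳ inc pre [ e ] (subst (λ z → 0 < bit z + 0) (sym eq) (s≤s z≤n))) (≤-pred h))
  ... | false = there (hit (pre ++ [ e ]) es x h)

  throughs-bound : ∀ {r s} Us {B : List E} → Free inc r s B Us →
    (∀ pre e es {X} → All (λ x → 0 < occ inc pre x) X → All (λ x → 0 < bit (inc e x)) X →
      All (λ x → i ≤ occ inc es x) X → Formation inc s (pre ++ e ∷ es) X) →
    ∀ pre es → B ≡ pre ++ es → sum (map (λ p → count p Us) (throughs pre es)) ≤ length es * r
  throughs-bound Us free form pre [] eq = z≤n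
  throughs-bound Us free form pre (e ∷ es) refl = +-mono-≤
    (≤-trans (≤-reflexive (count≡length-filter (through pre e es) Us))
      (free (filter-⊆ (T? ∘ through pre e es) Us) (form pre e es
        (All.map (λ t → <ᵇ⇒< 0 _ (proj₁ (T-∧⁻ t))) sat)
        (All.map (λ {x} t → <ᵇ⇒< 0 _ (proj₁ (T-∧⁻ (proj₂ (T-∧⁻ {0 <ᵇ occ inc pre x} t))))) sat)
        (All.map (λ {x} t → ≤ᵇ⇒≤ i _ (proj₂ (T-∧⁻ {0 <ᵇ bit (inc e x)} (proj₂ (T-∧⁻ {0 <ᵇ occ inc pre x} t))))) sat))))
    (throughs-bound Us free form (pre ++ [ e ]) es (sym (++-assoc pre [ e ] es)))
    where
    sat = Allₚ.all-filter (T? ∘ through pre e es) Us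

bounded-base : ∀ {r} i s →
  (∀ {A E : Set} (inc : E → A → Bool) pre e es {X} → All (λ x → 0 < occ inc pre x) X →
    All (λ x → 0 < bit (inc e x)) X → All (λ x → i ≤ occ inc es x) X → Formation inc s (pre ++ e ∷ es) X) →
  ∀ {M} → Bounded r (suc i) s r M
bounded-base {r} i s form = bounded go
  where
  go : ∀ {A E : Set} (inc : E → A → Bool) (B : List E) (Us : List A) → length B ≤ _ →
    All (λ x → suc i < occ inc B x) Us → Free inc r s B Us → length Us ≤ r * (length B ∸ 1)
  go inc [] [] l a free = z≤n
  go inc [] (x ∷ Us) l (() ∷ a) free
  go inc (e ∷ B) Us l a free = ≤-trans (covering-bound (throughs [ e ] B) Us (All.map hits a))
    (≤-trans (throughs-bound Us free (form inc) [ e ] B refl) (≤-reflexive (*-comm (length B) r)))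
    where
    open Base inc i
    hits : ∀ {x} → suc i < occ inc (e ∷ B) x → Any (λ p → T (p x)) (throughs [ e ] B)
    hits {x} h with inc e x in eq
    ... | true  = hit-after [ e ] B x (subst (λ z → 0 < bit z + 0) (sym eq) (s≤s z≤n)) (≤-pred h)
    ... | false = hit [ e ] B x h

bounded-2 : ∀ {r M} → Bounded r 1 2 r M
bounded-2 = bounded-base 0 2 λ inc pre e es hp he _ →
  pre , e ∷ es , refl , hp , [ e ] , es , refl , All.map (λ h → ≤-trans h (m≤m+n _ 0)) he , tt

bounded-3 : ∀ {r M} → Bounded r 2 3 r M
bounded-3 = bounded-base 1 3 λ inc pre e es hp he hq →
  pre , e ∷ es , refl , hp , [ e ] , es , refl , All.map (λ h → ≤-trans h (m≤m+n _ 0)) he ,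
  es , [] , sym (++-identityʳ es) , hq , tt

-- ack l j is the largest x with α_{l+1}(x) ≤ j.
ack : ℕ → ℕ → ℕ
ack zero    x       = 2 * x
ack (suc l) zero    = 1
ack (suc l) (suc j) = ack l (ack (suc l) j)

n<2^n : ∀ n → n < 2 ^ n
n<2^n zero    = s≤s z≤n
n<2^n (suc n) = ≤-trans (≤-trans (≤-reflexive (+-comm 1 (suc n))) (+-mono-≤ (n<2^n n) (m^n>0 2 n)))
  (≤-reflexive (cong (2 ^ n +_) (sym (+-identityʳ _))))

2^j≤ack : ∀ l j → 2 ^ j ≤ ack (suc l) j
2*≤ack : ∀ l x → 2 * x ≤ ack l x
2^j≤ack l zero    = ≤-refl
2^j≤ack l (suc j) = ≤-trans (*-monoʳ-≤ 2 (2^j≤ack l j)) (2*≤ack l (ack (suc l) j))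
2*≤ack zero    x       = ≤-refl
2*≤ack (suc l) zero    = z≤n
2*≤ack (suc l) (suc x) = ≤-trans (*-monoʳ-≤ 2 (≤-trans (n<2^n x) (2^j≤ack l x))) (2*≤ack l (ack (suc l) x))

ack-mono : ∀ l {x y} → x ≤ y → ack l x ≤ ack l y
ack-mono zero    h = *-monoʳ-≤ 2 h
ack-mono (suc l) {x} {y} h = go (≤⇒≤′ h)
  where
  go : ∀ {y} → x ≤′ y → ack (suc l) x ≤ ack (suc l) y
  go ≤′-refl = ≤-refl
  go (≤′-step h) = ≤-trans (go h) (≤-trans (m≤m+n _ _) (2*≤ack l _))

floor-log : ∀ b x → 2 ≤ b → 1 ≤ x → ∃[ i ] (b ^ i ≤ x × x < b ^ suc i)
floor-log b x 2≤b 1≤x = go x (<-≤-trans (n<2^n x) (^-monoˡ-≤ x 2≤b))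
  where
  go : ∀ n → x < b ^ n → ∃[ i ] (b ^ i ≤ x × x < b ^ suc i)
  go zero    h = ⊥-elim (<-irrefl refl (<-≤-trans h 1≤x))
  go (suc n) h with b ^ n ≤? x
  ... | yes p = n , p , h
  ... | no ¬p = go n (≰⇒> ¬p)

-- With b = 4 E + i, the product of (E + 1) ^ 4 and i + 1 lies between the two sides; for the upper
-- half, n + 1 ≤ 2 ^ n is applied to every factor.
linear≤2^ : ∀ E b → 4 * E ≤ b → E * suc b ≤ 2 ^ b
linear≤2^ E b h = begin
  E * suc b                           ≡⟨ cong (λ z → E * suc z) (sym (m+[n∸m]≡n h)) ⟩
  E * suc (4 * E + i)                 ≤⟨ m≤m+n _ _ ⟩
  E * suc (4 * E + i) + _             ≡⟨ sym (lem E i) ⟩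
  (suc E * suc E * (suc E * suc E)) * suc i
    ≤⟨ *-mono-≤ (*-mono-≤ (*-mono-≤ (n<2^n E) (n<2^n E)) (*-mono-≤ (n<2^n E) (n<2^n E))) (n<2^n i) ⟩
  2 ^ E * 2 ^ E * (2 ^ E * 2 ^ E) * 2 ^ i
    ≡⟨ cong (_* 2 ^ i) (cong₂ _*_ (sym (^-distribˡ-+-* 2 E E)) (sym (^-distribˡ-+-* 2 E E))) ⟩
  2 ^ (E + E) * 2 ^ (E + E) * 2 ^ i   ≡⟨ cong (_* 2 ^ i) (sym (^-distribˡ-+-* 2 (E + E) (E + E))) ⟩
  2 ^ (E + E + (E + E)) * 2 ^ i       ≡⟨ sym (^-distribˡ-+-* 2 (E + E + (E + E)) i) ⟩
  2 ^ (E + E + (E + E) + i)           ≡⟨ cong (λ z → 2 ^ (z + i)) (lem₂ E) ⟩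
  2 ^ (4 * E + i)                     ≡⟨ cong (2 ^_) (m+[n∸m]≡n h) ⟩
  2 ^ b ∎
  where
  open ≤-Reasoning
  i = b ∸ 4 * E
  lem : ∀ E i → (suc E * suc E * (suc E * suc E)) * suc i ≡
    E * suc (4 * E + i) + ((E * E * (E * E) + 4 * E * E * E + 2 * E * E + 3 * E + 1) + i * (E * E * (E * E) + 4 * E * E * E + 6 * E * E + 3 * E + 1))
  lem = solve-∀
  lem₂ : ∀ E → E + E + (E + E) ≡ 4 * E
  lem₂ = solve-∀

-- Opaque because thr 0 is already 2 ^ 64, which must not be unfolded.
opaque

  -- A symbol occurs at most once per block, so no symbol is rich enough in at most thr u blocks; this covers the x
  -- that are too small for the second alternative of root-step.
  thr : ℕ → ℕ
  thr u = ((2 ^ (2 + u)) ^ (4 * ((2 + u) * (2 + u)))) ^ (2 + u)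

  thr≡ : ∀ u → thr u ≡ ((2 ^ (2 + u)) ^ (4 * ((2 + u) * (2 + u)))) ^ (2 + u)
  thr≡ u = refl

-- Two steps of x ↦ x ^ e still fit below one step of the hierarchy: with y = 2 ^ b, y ^ e ≤ x and x ^ e ≤ 2 ^ y.
root-step : ∀ u x → 1 ≤ x →
  (x ^ (2 + u) ≤ thr u) ⊎ (∃[ y ] (1 ≤ y × y ≤ x × y ^ (2 + u) ≤ x × x ^ (2 + u) ≤ 2 ^ y))
root-step u x 1≤x with floor-log (2 ^ e) x (^-monoʳ-≤ 2 {1} {e} (s≤s z≤n)) 1≤x
  where e = 2 + u
-- 2 ^ b is the e-th root of x up to a factor 2. The test 4 e² ≤ b is what `linear≤2^` needs; if it
-- fails, x is below (2 ^ e) ^ (4 e²), whose e-th power is `thr u`.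
... | b , lo , hi with 4 * ((2 + u) * (2 + u)) ≤? b
...   | no ¬p = inj₁ (≤-trans (^-monoˡ-≤ (2 + u) (≤-trans (<⇒≤ hi) (^-monoʳ-≤ (2 ^ (2 + u)) {{m^n≢0 2 (2 + u)}} (≰⇒> ¬p)))) (≤-reflexive (sym (thr≡ u))))
...   | yes p = inj₂ (2 ^ b , m^n>0 2 b , ≤-trans (≤-trans (≤-reflexive (sym (^-identityʳ (2 ^ b))))
          (^-monoʳ-≤ (2 ^ b) {{m^n≢0 2 b}} {1} {e} (s≤s z≤n))) y^e≤x , y^e≤x , x^e≤)
  where
  open ≤-Reasoning
  e = 2 + u
  y^e≤x : (2 ^ b) ^ e ≤ x
  y^e≤x = begin
    (2 ^ b) ^ e   ≡⟨ ^-*-assoc 2 b e ⟩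
    2 ^ (b * e)   ≡⟨ cong (2 ^_) (*-comm b e) ⟩
    2 ^ (e * b)   ≡⟨ sym (^-*-assoc 2 e b) ⟩
    (2 ^ e) ^ b   ≤⟨ lo ⟩
    x ∎
  lem : ∀ e b → e * b * e ≡ e * e * b
  lem = solve-∀
  x^e≤ : x ^ e ≤ 2 ^ (2 ^ b)
  x^e≤ = begin
    x ^ e                      ≤⟨ ^-monoˡ-≤ e (<⇒≤ hi) ⟩
    ((2 ^ e) ^ suc b) ^ e      ≡⟨ cong (_^ e) (^-*-assoc 2 e (suc b)) ⟩
    (2 ^ (e * suc b)) ^ e      ≡⟨ ^-*-assoc 2 (e * suc b) e ⟩
    2 ^ (e * suc b * e)        ≡⟨ cong (2 ^_) (lem e (suc b)) ⟩
    2 ^ (e * e * suc b)        ≤⟨ ^-monoʳ-≤ 2 (linear≤2^ (e * e) b p) ⟩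
    2 ^ (2 ^ b) ∎

-- rich u d is the multiplicity that is sufficient for s = u + 2 at the level d + 2 of the hierarchy.
rich : ℕ → ℕ → ℕ
rich zero          d       = 1
rich (suc zero)    d       = 2
rich (suc (suc u)) zero    = rich (suc u) zero + (rich (suc u) zero + rich u zero * 2) + thr u
rich (suc (suc u)) (suc d) = rich (suc u) (suc d) + (rich (suc u) (suc d) + rich u (suc d) * rich (suc (suc u)) d)

1≤rich : ∀ u d → 1 ≤ rich u d
1≤rich zero          d       = ≤-refl
1≤rich (suc zero)    d       = s≤s z≤n
1≤rich (suc (suc u)) zero    = ≤-trans (1≤rich (suc u) zero) (≤-trans (m≤m+n _ _) (m≤m+n _ _))
1≤rich (suc (suc u)) (suc d) = ≤-trans (1≤rich (suc u) (suc d)) (m≤m+n _ _)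

thr≤rich : ∀ u d → thr u ≤ rich (2 + u) d
thr≤rich u zero    = m≤n+m _ _
thr≤rich u (suc d) = ≤-trans (thr≤rich u d) (≤-trans (≤-trans (≤-reflexive (sym (*-identityˡ _)))
  (*-monoˡ-≤ (rich (2 + u) d) (1≤rich u (suc d)))) (≤-trans (m≤n+m _ (rich (suc u) (suc d))) (m≤n+m _ (rich (suc u) (suc d)))))

-- The growth is only linear because R_2 = 1 multiplies the lower level. Products of such linear
-- factors give the logarithm in the exponent for even s.
rich-2-linear : ∀ d → rich 2 d ≡ rich 2 0 + 4 * d
rich-2-linear zero    = sym (+-identityʳ _)
rich-2-linear (suc d) = trans (cong (λ z → 2 + (2 + (z + 0))) (rich-2-linear d)) (lem (rich 2 0) d)
  where
  lem : ∀ a d → 2 + (2 + (a + 4 * d + 0)) ≡ a + 4 * suc d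
  lem = solve-∀

wt : ℕ → ℕ → ℕ → ℕ
wt r u d = r * 8 ^ (u + d)

-- The reason for the base 8 in `wt`: in units of q (j + 1) ^ (u + 1), two steps add at most 32 + 2
-- + 16 = 50, while passing from j to j + 1 provides 8 * 8 = 64.
weights≤ : ∀ q u j →
  2 * (2 * (8 * q * suc j ^ suc u) + q * suc j ^ u + 8 * q) + 64 * q * j ^ (2 + u) ≤ 64 * q * suc j ^ (2 + u)
weights≤ q u j = begin
  2 * (2 * (8 * q * (suc j * P)) + q * P + 8 * q) + 64 * q * (j * (j * j ^ u))
    ≤⟨ +-mono-≤ (*-monoʳ-≤ 2 (+-mono-≤ (+-monoʳ-≤ (2 * (8 * q * (suc j * P))) (*-monoʳ-≤ q (m≤n*m P (suc j))))
         (≤-trans (≤-reflexive (sym (*-identityʳ (8 * q)))) (*-monoʳ-≤ (8 * q) (m^n>0 (suc j) (suc u))))))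
        (*-monoʳ-≤ (64 * q) (*-monoʳ-≤ j (*-mono-≤ (n≤1+n j) (^-monoˡ-≤ u (n≤1+n j))))) ⟩
  2 * (2 * (8 * q * (suc j * P)) + q * (suc j * P) + 8 * q * (suc j * P)) + 64 * q * (j * (suc j * P))
    ≤⟨ m≤m+n _ (14 * q * (suc j * P)) ⟩
  2 * (2 * (8 * q * (suc j * P)) + q * (suc j * P) + 8 * q * (suc j * P)) + 64 * q * (j * (suc j * P)) + 14 * q * (suc j * P)
    ≡⟨ lem q j P ⟩
  64 * q * (suc j * (suc j * P)) ∎
  where
  open ≤-Reasoning
  P = suc j ^ u
  lem : ∀ q j P → 2 * (2 * (8 * q * ((1 + j) * P)) + q * ((1 + j) * P) + 8 * q * ((1 + j) * P)) + 64 * q * (j * ((1 + j) * P))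
    + 14 * q * ((1 + j) * P) ≡ 64 * q * ((1 + j) * ((1 + j) * P))
  lem = solve-∀

wt-suc : ∀ r u d → wt r (suc u) d ≡ 8 * wt r u d
wt-suc r u d = lem r (8 ^ (u + d))
  where
  lem : ∀ r a → r * (8 * a) ≡ 8 * (r * a)
  lem = solve-∀

wt-lower : ∀ r u d → wt r (2 + u) d ≡ 8 * wt r u (suc d)
wt-lower r u d = trans (wt-suc r (suc u) d) (cong (λ z → 8 * (r * 8 ^ z)) (sym (+-suc u d)))

r≤wt : ∀ r u d → r ≤ wt r u d
r≤wt r u d = ≤-trans (≤-reflexive (sym (*-identityʳ r))) (*-monoʳ-≤ r (m^n>0 8 (u + d)))

-- The weights of two steps are collected here: w₀ already contains that of the first one.
two-steps≤ : ∀ u j {q c₁ c w₁ w₂ w₃ w₀} → c₁ ≡ 8 * q → c ≡ 8 * c₁ → w₁ ≡ c₁ * suc j ^ (1 + u) → w₂ ≡ q * suc j ^ u →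
  w₃ ≤ 8 * q → w₀ ≤ c * j ^ (2 + u) + (2 * w₁ + w₂ + w₃) → w₀ + 2 * w₁ + w₂ + w₃ ≤ c * suc j ^ (2 + u)
two-steps≤ u j {q} {c₁} {c} {w₁} {w₂} {w₃} {w₀} refl refl refl refl h₃ h₀ = begin
  w₀ + 2 * w₁ + w₂ + w₃
    ≤⟨ +-monoˡ-≤ w₃ (+-monoˡ-≤ w₂ (+-monoˡ-≤ (2 * w₁) h₀)) ⟩
  (c * j ^ (2 + u) + (2 * w₁ + w₂ + w₃)) + 2 * w₁ + w₂ + w₃
    ≡⟨ lem (c * j ^ (2 + u)) w₁ w₂ w₃ ⟩
  2 * (2 * w₁ + w₂ + w₃) + c * j ^ (2 + u)
    ≤⟨ +-mono-≤ (*-monoʳ-≤ 2 (+-monoʳ-≤ (2 * w₁ + w₂) h₃)) (≤-reflexive (cong (_* j ^ (2 + u)) (lem₂ q))) ⟩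
  2 * (2 * w₁ + w₂ + 8 * q) + 64 * q * j ^ (2 + u)
    ≤⟨ weights≤ q u j ⟩
  64 * q * suc j ^ (2 + u)
    ≡⟨ cong (_* suc j ^ (2 + u)) (sym (lem₂ q)) ⟩
  c * suc j ^ (2 + u) ∎
  where
  open ≤-Reasoning
  lem : ∀ a b c d → (a + (2 * b + c + d)) + 2 * b + c + d ≡ 2 * (2 * b + c + d) + a
  lem = solve-∀
  lem₂ : ∀ q → 8 * (8 * q) ≡ 64 * q
  lem₂ = solve-∀

module _ (r : ℕ) where

  At : ℕ → ℕ → ℕ → Set₁
  At u d j = Bounded r (rich u d) (2 + u) (wt r u d * j ^ u) (ack (suc d) j)

  -- The range to reach is `ack (suc d) x`. Groups of x ^ e blocks cancel the factor x ^ e in the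
  -- weight of the lower level, but `b₀` handles only x blocks. So a first step is made with a root
  -- y of x: its groups of y ^ e ≤ x blocks are covered by `b₀`, and its range, at least 2 ^ y,
  -- includes x ^ e.
  bounded-ack-suc : ∀ u d j → At (2 + u) (suc d) j → At (1 + u) (suc d) (suc j) → At u (suc d) (suc j) →
    (∀ y → At (2 + u) d y) → At (2 + u) (suc d) (suc j)
  bounded-ack-suc u d j b₀ b₁ b₂ b₃ = bounded-mono ≤-refl
    (two-steps≤ u j {wt r u (suc d)} (wt-suc r u (suc d)) (wt-suc r (suc u) (suc d)) refl refl (≤-reflexive (wt-lower r u d)) (≤-refl {W₀})) ≤-refl
    (step x (x ^ e) 1≤x refl ≤-refl from-root)
    where
    e = 2 + u
    x = ack (2 + d) j
    1≤x = ≤-trans (m^n>0 2 j) (2^j≤ack (suc d) j)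
    k = rich (2 + u) (suc d)
    W₁ = wt r (1 + u) (suc d) * suc j ^ (1 + u)
    W₂ = wt r u (suc d) * suc j ^ u
    W₃ = wt r (2 + u) d
    W₀ = wt r (2 + u) (suc d) * j ^ (2 + u) + (2 * W₁ + W₂ + W₃)
    step : ∀ {w} y t → 1 ≤ y → t ≡ y ^ e → y ≤ x → Bounded r k (4 + u) w t →
      Bounded r k (4 + u) (w + 2 * W₁ + W₂ + W₃) (ack (suc d) y)
    step y t 1≤y refl y≤x b = recurrence {w₃ = W₃} t M 1≤t (≤-trans (≤-reflexive (sym (*-identityʳ M))) (*-monoʳ-≤ M 1≤t)) ≤-refl
      (bounded-mono ≤-refl ≤-refl (m⊓n≤m _ _) b)
      (bounded-mono ≤-refl ≤-refl (≤-trans (m⊓n≤n t _) M≤) b₁)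
      (bounded-mono ≤-refl ≤-refl (≤-trans (m⊓n≤n t _) M≤) b₂)
      (b₃ y)
      where
      M = ack (suc d) y
      M≤ = ack-mono (suc d) y≤x
      1≤t = m^n>0 y {{>-nonZero 1≤y}} e
    from-root : Bounded r k (4 + u) W₀ (x ^ e)
    from-root with root-step u x 1≤x
    ... | inj₁ small = bounded-mono ≤-refl z≤n ≤-refl (bounded-vanish (≤-trans small (thr≤rich u (suc d))))
    ... | inj₂ (y , 1≤y , y≤x , y^e≤x , x^e≤) = bounded-mono ≤-refl
          (≤-reflexive (lem (wt r (2 + u) (suc d) * j ^ (2 + u)) W₁ W₂ W₃)) (≤-trans x^e≤ (2^j≤ack d y))
          (step y (y ^ e) 1≤y refl y≤x (bounded-mono ≤-refl ≤-refl y^e≤x b₀))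
      where
      lem : ∀ a b c d → a + 2 * b + c + d ≡ a + (2 * b + c + d)
      lem = solve-∀

  bounded-ack : ∀ u d j → At u d j
  bounded-ack zero d j =
    bounded-mono ≤-refl (≤-trans (r≤wt r 0 d) (≤-reflexive (sym (*-identityʳ _)))) ≤-refl (bounded-2 {M = ack (suc d) j})
  bounded-ack (suc zero) d zero =
    bounded-mono ≤-refl z≤n ≤-refl (bounded-vanish (s≤s z≤n))
  bounded-ack (suc zero) d (suc j) =
    bounded-mono ≤-refl (≤-trans (r≤wt r 1 d) (m≤m*n _ (suc j ^ 1) {{m^n≢0 (suc j) 1}})) ≤-refl (bounded-3 {M = ack (suc d) (suc j)})
  bounded-ack (suc (suc u)) zero zero =
    bounded-mono ≤-refl z≤n ≤-refl (bounded-vanish (1≤rich (2 + u) 0))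
  -- At the lowest level, passing to j + 1 doubles the range. Two groups suffice, and no symbol lies
  -- in more than two: k₃ = 2 and w₃ = 0.
  bounded-ack (suc (suc u)) zero (suc j) = bounded-mono ≤-refl
    (two-steps≤ u j {wt r u 0} (wt-suc r u 0) (wt-suc r (suc u) 0) refl refl z≤n (m≤m+n (wt r (2 + u) 0 * j ^ (2 + u)) _)) ≤-refl
    (recurrence {k₃ = 2} {w₀ = wt r (2 + u) 0 * j ^ (2 + u)} {w₃ = 0} (ack 1 j) 2 (≤-trans (m^n>0 2 j) (2^j≤ack 0 j)) ≤-refl
      (m≤m+n _ (thr u))
      (bounded-mono ≤-refl ≤-refl (m⊓n≤m _ _) (bounded-ack (suc (suc u)) 0 j))
      (bounded-mono ≤-refl ≤-refl (m⊓n≤n (ack 1 j) _) (bounded-ack (suc u) 0 (suc j)))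
      (bounded-mono ≤-refl ≤-refl (m⊓n≤n (ack 1 j) _) (bounded-ack u 0 (suc j)))
      (bounded-vanish ≤-refl))
  bounded-ack (suc (suc u)) (suc d) zero =
    bounded-mono ≤-refl z≤n ≤-refl (bounded-vanish (1≤rich (2 + u) (suc d)))
  bounded-ack (suc (suc u)) (suc d) (suc j) =
    bounded-ack-suc u d j (bounded-ack (suc (suc u)) (suc d) j) (bounded-ack (suc u) (suc d) (suc j)) (bounded-ack u (suc d) (suc j))
      (bounded-ack (suc (suc u)) d)

  -- For s = 4 the square in bounded-ack is avoidable: a single step per level suffices, so the weights grow
  -- linearly in d.
  bounded-ack-4 : ∀ d j → Bounded r (rich 2 d) 4 (3 * r * suc d * j) (ack (suc d) j)
  bounded-ack-4 d zero = bounded-mono ≤-refl z≤n ≤-refl (bounded-vanish (1≤rich 2 d))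
  bounded-ack-4 zero (suc j) = bounded-mono ≤-refl (≤-reflexive (lem r j)) ≤-refl
    (recurrence {k₃ = 2} {w₃ = 0} (ack 1 j) 2 (≤-trans (m^n>0 2 j) (2^j≤ack 0 j)) ≤-refl (m≤m+n 6 _)
      (bounded-mono ≤-refl ≤-refl (m⊓n≤m _ _) (bounded-ack-4 0 j)) bounded-3 bounded-2 (bounded-vanish ≤-refl))
    where
    lem : ∀ r j → 3 * r * 1 * j + 2 * r + r + 0 ≡ 3 * r * 1 * suc j
    lem = solve-∀
  bounded-ack-4 (suc d) (suc j) = bounded-mono ≤-refl (≤-reflexive (lem r d j)) ≤-refl
    (recurrence {w₃ = 3 * r * suc d} x M 1≤x (≤-trans (≤-reflexive (sym (*-identityʳ M))) (*-monoʳ-≤ M 1≤x)) ≤-refl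
      (bounded-mono ≤-refl ≤-refl (m⊓n≤m _ _) (bounded-ack-4 (suc d) j)) bounded-3 bounded-2 (bounded-ack-4 d x))
    where
    x = ack (2 + d) j
    M = ack (suc d) x
    1≤x = ≤-trans (m^n>0 2 j) (2^j≤ack (suc d) j)
    lem : ∀ r d j → 3 * r * (2 + d) * j + 2 * r + r + 3 * r * (1 + d) ≡ 3 * r * (2 + d) * suc j
    lem = solve-∀

  opaque

    -- Grouping t blocks, where t is the weight itself but at most the multiplicity, makes the weight constant.
    bounded-4 : 1 ≤ r → ∃[ K ] ∃[ W ] (∀ d → Bounded r (K * suc d) 4 W (ack (suc d) 5))
    bounded-4 1≤r = rich 2 0 + 4 + 15 * r , 0 + 2 * r + r + 1 , λ d → let t = 3 * r * suc d * 5 ; M = ack (suc d) 5 in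
      recurrence {k = (rich 2 0 + 4 + 15 * r) * suc d} {k₁ = 2} {k₂ = 1} {k₃ = rich 2 d} {w₀ = 0} {w₃ = 1} t M (1≤t d) (M≤ d M) (k≥ d)
        (bounded-vanish (≤-trans (m⊓n≤m t M) (≤-trans (≤-reflexive (lem₁ r d)) (≤-trans (m≤n+m _ ((rich 2 0 + 4) * suc d)) (≤-reflexive (sym (*-distribʳ-+ (suc d) (rich 2 0 + 4) (15 * r))))))))
        bounded-3 bounded-2 (bounded-mono ≤-refl (≤-reflexive (sym (*-identityˡ t))) ≤-refl (bounded-ack-4 d 5))
      where
      lem₁ : ∀ r d → 3 * r * suc d * 5 ≡ 15 * r * suc d
      lem₁ = solve-∀
      1≤t : ∀ d → 1 ≤ 3 * r * suc d * 5
      1≤t d = *-mono-≤ (*-mono-≤ (*-mono-≤ (s≤s (z≤n {2})) 1≤r) (s≤s (z≤n {d}))) (s≤s (z≤n {4}))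
      M≤ : ∀ d M → M ≤ M * (3 * r * suc d * 5)
      M≤ d M = ≤-trans (≤-reflexive (sym (*-identityʳ M))) (*-monoʳ-≤ M (1≤t d))
      lem₂ : ∀ a d r → 2 + (2 + 1 * (a + 4 * d)) + (a * d + 15 * r * suc d) ≡ (a + 4 + 15 * r) * suc d
      lem₂ = solve-∀
      k≥ : ∀ d → 2 + (2 + 1 * rich 2 d) ≤ (rich 2 0 + 4 + 15 * r) * suc d
      k≥ d = ≤-trans (≤-reflexive (cong (λ z → 2 + (2 + 1 * z)) (rich-2-linear d))) (≤-trans (m≤m+n _ _) (≤-reflexive (lem₂ (rich 2 0) d r)))

  -- Grouping 2 ^ d blocks divides the weight by 2 ^ d, at the cost of a constant factor in the multiplicity.
  divide-weight : ∀ {d k w M} → Bounded r k 5 (2 ^ d * w) M → Bounded r (2 * k + 2 * 2 ^ d) 5 (r + w) M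
  -- A group has at most 2 ^ d blocks, so the choice k₁ = 2 ^ d empties the starting and ending
  -- classes; inside the groups only the middle class is left, with weight r.
  divide-weight {d} {k} {w} {M} b = recurrence {k₁ = 2 ^ d} {k₂ = 2} {k₃ = k} {w₀ = 0} {w₁ = 0} {w₃ = w} (2 ^ d) M (m^n>0 2 d)
    (≤-trans (≤-reflexive (sym (*-identityʳ M))) (*-monoʳ-≤ M (m^n>0 2 d))) (≤-reflexive (lem (2 ^ d) k))
    (bounded-vanish (≤-trans (m⊓n≤m _ M) (≤-trans (m≤m+n (2 ^ d) _) (m≤n+m _ (2 * k)))))
    (bounded-vanish (m⊓n≤m _ M)) bounded-3 (bounded-mono ≤-refl (≤-reflexive (*-comm (2 ^ d) w)) ≤-refl b)
    where
    lem : ∀ a k → a + (a + 2 * k) ≡ 2 * k + 2 * a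
    lem = solve-∀

  -- Each round removes one factor 2 ^ d and triples the constant in front of k + 2 ^ d. The weight
  -- 8 ^ d of s = 5 takes three rounds.
  divide-weights : ∀ i c → ∃[ K ] ∃[ W ] (∀ {d k M} → Bounded r k 5 ((2 ^ d) ^ i * c) M → Bounded r (K * (k + 2 ^ d)) 5 W M)
  divide-weights zero c = 1 , 1 * c , λ b → bounded-mono (≤-trans (m≤m+n _ _) (m≤m+n _ _)) ≤-refl ≤-refl b
  divide-weights (suc i) c with divide-weights i (r + c)
  ... | K , W , f = K * 3 , W , λ {d} {k} {M} b →
    bounded-mono (≤-trans (*-monoʳ-≤ K (≤-trans (m≤m+n _ k) (≤-reflexive (lem k (2 ^ d))))) (≤-reflexive (sym (*-assoc K 3 _)))) ≤-refl ≤-refl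
      (f {d} (bounded-mono ≤-refl (weight d) ≤-refl
        (divide-weight {d} {k} {(2 ^ d) ^ i * c} (bounded-mono ≤-refl (≤-reflexive (*-assoc (2 ^ d) ((2 ^ d) ^ i) c)) ≤-refl b))))
    where
    lem : ∀ k a → (2 * k + 2 * a) + a + k ≡ 3 * (k + a)
    lem = solve-∀
    weight : ∀ d → r + (2 ^ d) ^ i * c ≤ (2 ^ d) ^ i * (r + c)
    weight d = ≤-trans (+-monoˡ-≤ _ (≤-trans (≤-reflexive (sym (*-identityˡ r))) (*-monoˡ-≤ r (m^n>0 (2 ^ d) {{m^n≢0 2 d}} i))))
      (≤-reflexive (sym (*-distribˡ-+ ((2 ^ d) ^ i) r c)))

  weight-split : ∀ m e d → r * 8 ^ (m + d) * e ≡ (2 ^ d) ^ 3 * (r * 8 ^ m * e)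
  weight-split m e d = begin
    r * 8 ^ (m + d) * e       ≡⟨ cong (λ z → r * z * e) (^-distribˡ-+-* 8 m d) ⟩
    r * (8 ^ m * 8 ^ d) * e   ≡⟨ swap r (8 ^ m) (8 ^ d) e ⟩
    8 ^ d * (r * 8 ^ m * e)
      ≡⟨ cong (_* (r * 8 ^ m * e)) (trans (^-*-assoc 2 3 d) (trans (cong (2 ^_) (*-comm 3 d)) (sym (^-*-assoc 2 d 3)))) ⟩
    (2 ^ d) ^ 3 * (r * 8 ^ m * e) ∎
    where
    open ≡-Reasoning
    swap : ∀ r a b c → r * (a * b) * c ≡ b * (r * a * c)
    swap = solve-∀

  bounded-ack′ : ∀ u j → ∃[ c ] (∀ d → Bounded r (rich u d) (2 + u) ((2 ^ d) ^ 3 * c) (ack (suc d) j))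
  bounded-ack′ u j = r * 8 ^ u * j ^ u , λ d →
    bounded-mono ≤-refl (≤-reflexive (weight-split u (j ^ u) d)) ≤-refl (bounded-ack u d j)

  opaque

    bounded-5 : ∃[ K ] ∃[ W ] (∀ d → Bounded r (K * (rich 3 d + 2 ^ d)) 5 W (ack (suc d) 5))
    bounded-5 = combine (divide-weights 3 (proj₁ (bounded-ack′ 3 5))) (proj₂ (bounded-ack′ 3 5))
      where
      combine : ∀ {c} →
        ∃[ K ] ∃[ W ] (∀ {d k M} → Bounded r k 5 ((2 ^ d) ^ 3 * c) M → Bounded r (K * (k + 2 ^ d)) 5 W M) →
        (∀ d → Bounded r (rich 3 d) 5 ((2 ^ d) ^ 3 * c) (ack (suc d) 5)) →
        ∃[ K ] ∃[ W ] (∀ d → Bounded r (K * (rich 3 d + 2 ^ d)) 5 W (ack (suc d) 5))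
      combine (K , W , f) h = K , W , λ d → f {d} (h d)

-- The inverse Ackermann functions

n≤2*⌈n/2⌉ : ∀ n → n ≤ 2 * ⌈ n /2⌉
n≤2*⌈n/2⌉ zero          = z≤n
n≤2*⌈n/2⌉ (suc zero)    = s≤s z≤n
n≤2*⌈n/2⌉ (suc (suc n)) = ≤-trans (s≤s (s≤s (n≤2*⌈n/2⌉ n))) (≤-reflexive (sym (*-suc 2 ⌈ n /2⌉)))

iterCount-small : ∀ f fuel {y} → y ≤ 1 → iterCount f fuel y ≡ 0
iterCount-small f zero       h = refl
iterCount-small f (suc fuel) {y} h with y ≤? 1
... | yes _ = refl
... | no ¬p = ⊥-elim (¬p h)

iterCount≤half : ∀ f → (∀ y → f y ≤ ⌈ y /2⌉) → ∀ fuel x → iterCount f fuel x ≤ ⌈ x /2⌉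
iterCount≤half f hf zero x = z≤n
iterCount≤half f hf (suc fuel) x with x ≤? 1
... | yes _ = z≤n
... | no ¬p with f x ≤? 1
...   | yes q = ≤-trans (≤-reflexive (cong suc (iterCount-small f fuel q))) (⌈n/2⌉-mono (<⇒≤ (≰⇒> ¬p)))
...   | no ¬q = ≤-trans (s≤s (≤-trans (iterCount≤half f hf fuel (f x)) (⌈n/2⌉-mono (hf x)))) (half< (≤-trans (≰⇒> ¬q) (hf x)))
  where
  half< : ∀ {h} → 2 ≤ h → ⌈ h /2⌉ < h
  half< {suc (suc h)} _ = ⌈n/2⌉<n h
  half< {suc zero} (s≤s ())

alphaK≤half : ∀ l x → alphaK (suc l) x ≤ ⌈ x /2⌉
alphaK≤half zero    x = ≤-refl
alphaK≤half (suc l) x = iterCount≤half (alphaK (suc l)) (alphaK≤half l) x x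

-- Each iteration of f is undone by one application of `ack l`, and the iteration stops at 1, which
-- is `ack (suc l) 0`. Halving makes the argument decrease, so the fuel lasts.
ack-iterCount : ∀ l f → (∀ y → y ≤ ack l (f y)) → (∀ y → f y ≤ ⌈ y /2⌉) → ∀ fuel x → x ≤ fuel → x ≤ ack (suc l) (iterCount f fuel x)
ack-iterCount l f inv hf zero       x h = ≤-trans h z≤n
ack-iterCount l f inv hf (suc fuel) x h with x ≤? 1
... | yes p = p
... | no ¬p = ≤-trans (inv x) (ack-mono l (ack-iterCount l f inv hf fuel (f x) (≤-pred (≤-trans (f< x (≰⇒> ¬p)) h))))
  where
  f< : ∀ x → 1 < x → f x < x
  f< (suc (suc x)) _ = ≤-<-trans (hf _) (⌈n/2⌉<n x)
  f< (suc zero) (s≤s ())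

≤ack-alphaK : ∀ l x → x ≤ ack l (alphaK (suc l) x)
≤ack-alphaK zero    x = n≤2*⌈n/2⌉ x
≤ack-alphaK (suc l) x = ack-iterCount l (alphaK (suc l)) (≤ack-alphaK l) (alphaK≤half l) x x ≤-refl

-- For y = α_(l+1)(x) the next level is at most 1 + ⌈y/2⌉, which is below y exactly when y > 3.
alphaK-decreasing : ∀ l x → 3 < alphaK (suc l) x → alphaK (suc (suc l)) x < alphaK (suc l) x
alphaK-decreasing l zero h = ⊥-elim (n≮0 (<-≤-trans h (alphaK≤half l 0)))
alphaK-decreasing l (suc x) h with suc x ≤? 1
... | yes p = ⊥-elim (n≮0 (≤-pred (<-≤-trans h (≤-trans (alphaK≤half l (suc x)) (⌈n/2⌉-mono p)))))
... | no ¬p = ≤-<-trans (s≤s (iterCount≤half (alphaK (suc l)) (alphaK≤half l) x (alphaK (suc l) (suc x)))) (half+1< h)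
  where
  half+1< : ∀ {y} → 3 < y → suc ⌈ y /2⌉ < y
  half+1< (s≤s (s≤s (s≤s (s≤s {n = z} _)))) = s≤s (s≤s (s≤s (s≤s (⌈n/2⌉≤n z))))

alphaSearch-reaches : ∀ fuel k x → alphaK (suc k) x ≤ 3 + fuel → alphaK (alphaSearch fuel (suc k) x) x ≤ 3
alphaSearch-reaches zero       k x h = h
alphaSearch-reaches (suc fuel) k x h with alphaK (suc k) x ≤? 3
... | yes p = p
... | no ¬p = alphaSearch-reaches fuel (suc k) x (≤-pred (≤-trans (alphaK-decreasing k x (≰⇒> ¬p)) h))

≤alphaSearch : ∀ fuel k x → k ≤ alphaSearch fuel k x
≤alphaSearch zero       k x = ≤-refl
≤alphaSearch (suc fuel) k x with alphaK k x ≤? 3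
... | yes _ = ≤-refl
... | no _  = ≤-trans (n≤1+n k) (≤alphaSearch fuel (suc k) x)

alphaK-alpha : ∀ n → alphaK (alpha n) n ≤ 3
alphaK-alpha n = alphaSearch-reaches (n + 4) 0 n (≤-trans (⌈n/2⌉≤n n) (≤-trans (m≤m+n n 4) (m≤n+m _ 3)))

2≤alpha : ∀ n → 7 ≤ n → 2 ≤ alpha n
2≤alpha (suc n) h with ⌈ suc n /2⌉ ≤? 3
... | yes p = ⊥-elim (<-irrefl refl (<-≤-trans (⌈n/2⌉-mono h) p))
... | no _  = ≤alphaSearch (n + 4) 2 (suc n)

-- The argument 5 is 3 + 2: n ≤ `ack (suc d) 3` by the choice of α(n), and two more iterations at
-- least double twice. This makes room for the 4 n groups into which a sequence is cut.
level-of-alpha : ∀ n → 7 ≤ n → ∃[ d ] (alpha n ≡ 2 + d × 4 * n ≤ ack (suc d) 5)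
level-of-alpha n h with alpha n | 2≤alpha n h | alphaK-alpha n
... | suc (suc d) | _ | a≤3 = d , refl , ≤-trans (≤-reflexive (*-assoc 2 2 n))
  (≤-trans (*-monoʳ-≤ 2 (≤-trans (*-monoʳ-≤ 2 (≤-trans (≤ack-alphaK (suc d) n) (ack-mono (suc d) a≤3)))
    (2*≤ack d (ack (suc d) 3)))) (2*≤ack d (ack (suc d) 4)))
... | suc zero | s≤s () | _

-- From sequences to blocks

⊆-++⁻ : {A : Set} {X : List A} (ys : List A) {zs : List A} → X ⊆ ys ++ zs →
  ∃[ X₁ ] ∃[ X₂ ] (X ≡ X₁ ++ X₂ × X₁ ⊆ ys × X₂ ⊆ zs)
⊆-++⁻ []       h = [] , _ , refl , [] , h
⊆-++⁻ (y ∷ ys) (.y ∷ʳ h) with ⊆-++⁻ ys h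
... | X₁ , X₂ , refl , p , q = X₁ , X₂ , refl , y ∷ʳ p , q
⊆-++⁻ (y ∷ ys) (refl ∷ h) with ⊆-++⁻ ys h
... | X₁ , X₂ , refl , p , q = y ∷ X₁ , X₂ , refl , refl ∷ p , q

-- The occurrences of x are cut into windows of K consecutive ones; (x , o) stands for the window starting with the
-- o-th occurrence of x (counted from 0), as a symbol of its own.
module Windows {A E : Set} (inc : E → A → Bool) (k : ℕ) where

  K : ℕ
  K = suc k

  annotate : (A → ℕ) → List E → List (E × (A → ℕ))
  annotate c []      = []
  annotate c (e ∷ B) = (e , c) ∷ annotate (λ x → bit (inc e x) + c x) B

  incʷ : E × (A → ℕ) → A × ℕ → Bool
  incʷ (e , c) (x , o) = inc e x ∧ ((o ≤ᵇ c x) ∧ (c x <ᵇ o + K))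

  length-annotate : ∀ c B → length (annotate c B) ≡ length B
  length-annotate c []      = refl
  length-annotate c (e ∷ B) = cong suc (length-annotate _ B)

  proj₁-annotate : ∀ c B → map proj₁ (annotate c B) ≡ B
  proj₁-annotate c []      = refl
  proj₁-annotate c (e ∷ B) = cong (e ∷_) (proj₁-annotate _ B)

  window-full : ∀ B c x o → o + K ≤ c x + occ inc B x → o + K ≤ (c x ⊔ o) + occ incʷ (annotate c B) (x , o)
  window-full [] c x o h = ≤-trans h (+-monoˡ-≤ 0 (m≤m⊔n (c x) o))
  window-full (e ∷ B) c x o h
    with inc e x | window-full B (λ y → bit (inc e y) + c y) x o
      (≤-trans h (≤-reflexive (lem (c x) (bit (inc e x)) (occ inc B x))))
    where
    lem : ∀ a b d → a + (b + d) ≡ b + a + d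
    lem = solve-∀
  ... | false | ih = ih
  ... | true  | ih with o ≤ᵇ c x in le | c x <ᵇ o + K in lt
  ...   | true | true = ≤-trans ih (≤-trans (+-monoˡ-≤ _ (⊔-lub (s≤s (m≤m⊔n (c x) o)) (≤-trans (m≤n⊔m (c x) o) (n≤1+n _))))
                          (≤-reflexive (sym (+-suc (c x ⊔ o) _))))
  ...   | true | false = ≤-trans (≮⇒≥ (λ p → subst T lt (<⇒<ᵇ p))) (≤-trans (m≤m⊔n (c x) o) (m≤m+n _ _))
  ...   | false | _ = ≤-trans ih (+-monoˡ-≤ _ (⊔-lub (≤-trans (≰⇒> (λ p → subst T le (≤⇒≤ᵇ p))) (m≤n⊔m (c x) o)) (m≤n⊔m (c x) o)))

  incʷ⇒ : ∀ e c x o → T (incʷ (e , c) (x , o)) → o ≤ c x × c x < o + K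
  incʷ⇒ e c x o t with T-∧⁻ {inc e x} t
  ... | _ , t′ with T-∧⁻ {o ≤ᵇ c x} t′
  ...   | t₁ , t₂ = ≤ᵇ⇒≤ o (c x) t₁ , <ᵇ⇒< (c x) (o + K) t₂

  window-late : ∀ B c x o → 0 < occ incʷ (annotate c B) (x , o) → c x < o + K
  window-late (e ∷ B) c x o h with incʷ (e , c) (x , o) in eq
  ... | true  = proj₂ (incʷ⇒ e c x o (subst T (sym eq) tt))
  ... | false = ≤-<-trans (m≤n+m (c x) (bit (inc e x))) (window-late B _ x o h)

  windows-ordered : ∀ B c x o o′ B₁ B₂ → annotate c B ≡ B₁ ++ B₂ → 0 < occ incʷ B₁ (x , o) → 0 < occ incʷ B₂ (x , o′) →
    ¬ (o′ + K ≤ o)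
  windows-ordered (e ∷ B) c x o o′ (b ∷ B₁) B₂ eq h₁ h₂ le with ∷-injective eq
  ... | refl , eq′ with incʷ (e , c) (x , o) in in?
  ...   | true  = <-irrefl refl (<-≤-trans
                    (window-late B _ x o′ (subst (λ z → 0 < occ incʷ z (x , o′)) (sym eq′) (occurs-++ʳ incʷ B₁ B₂ {x , o′} h₂)))
                    (≤-trans le (≤-trans (proj₁ (incʷ⇒ e c x o (subst T (sym in?) tt))) (m≤n+m (c x) _))))
  ...   | false = windows-ordered B _ x o o′ B₁ B₂ eq′ h₁ h₂ le

  windows : A → ℕ → List (A × ℕ)
  windows x zero    = []
  windows x (suc q) = (x , q * K) ∷ windows x q

  length-windows : ∀ x q → length (windows x q) ≡ q
  length-windows x zero    = refl
  length-windows x (suc q) = cong suc (length-windows x q)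

  All-windows : ∀ x q → All (λ u → proj₁ u ≡ x × proj₂ u + K ≤ q * K) (windows x q)
  All-windows x zero    = []
  All-windows x (suc q) = (refl , ≤-reflexive (+-comm (q * K) K)) ∷
    All.map (λ { (e , h) → e , ≤-trans h (m≤n+m _ K) }) (All-windows x q)

  allWindows : (A → ℕ) → List A → List (A × ℕ)
  allWindows q []       = []
  allWindows q (x ∷ Us) = windows x (q x) ++ allWindows q Us

  NoClash : List (A × ℕ) → Set
  NoClash X = ∀ {x o o′} → (x , o) ∈ X → (x , o′) ∈ X → ¬ (o′ + K ≤ o)

  one-window : ∀ x q {X} → NoClash X → X ⊆ windows x q → map proj₁ X ⊆ [ x ]
  one-window x zero    nc []       = x ∷ʳ []
  one-window x (suc q) nc (_ ∷ʳ h) = one-window x q nc h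
  one-window x (suc q) {_ ∷ []} nc (refl ∷ h) = refl ∷ []
  one-window x (suc q) {_ ∷ _ ∷ X} nc (refl ∷ h) with All.head (All-resp-⊆ h (All-windows x q))
  ... | refl , le = ⊥-elim (nc (here refl) (there (here refl)) le)

  symbols-of-windows : ∀ q Us {X} → NoClash X → X ⊆ allWindows q Us → map proj₁ X ⊆ Us
  symbols-of-windows q [] nc [] = []
  symbols-of-windows q (x ∷ Us) nc h with ⊆-++⁻ (windows x (q x)) h
  ... | X₁ , X₂ , refl , p₁ , p₂ = subst (_⊆ x ∷ Us) (sym (map-++ proj₁ X₁ X₂))
    (++⁺ (one-window x (q x) (λ i j → nc (∈-++⁺ˡ i) (∈-++⁺ˡ j)) p₁)
         (symbols-of-windows q Us (λ i j → nc (∈-++⁺ʳ X₁ i) (∈-++⁺ʳ X₁ j)) p₂))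

  occ-proj₁ : ∀ B u → occ incʷ B u ≤ occ inc (map proj₁ B) (proj₁ u)
  occ-proj₁ []            u       = z≤n
  occ-proj₁ ((e , c) ∷ B) (x , o) with inc e x
  ... | true  = +-mono-≤ (bit≤1 _) (occ-proj₁ B (x , o))
  ... | false = occ-proj₁ B (x , o)

  formation-proj₁ : ∀ s {B X} → Formation incʷ s B X → Formation inc s (map proj₁ B) (map proj₁ X)
  formation-proj₁ zero    f = tt
  formation-proj₁ (suc s) (B₁ , B₂ , refl , h , f) =
    map proj₁ B₁ , map proj₁ B₂ , map-++ proj₁ B₁ B₂ , Allₚ.map⁺ (All.map (λ {u} p → ≤-trans p (occ-proj₁ B₁ u)) h) , formation-proj₁ s f

  -- Two windows of one symbol cannot share a formation with at least two permutations: the later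
  -- window would occur in the first segment and the earlier one in a subsequent segment. So
  -- projecting windows to their symbols loses none of them.
  free-windows : ∀ {r s} q Us B → Free inc r (2 + s) B Us → Free incʷ r (2 + s) (annotate (λ _ → 0) B) (allWindows q Us)
  free-windows {s = s} q Us B free {X} X⊆ f@(B₁ , B₂ , eq , h₁ , B₃ , B₄ , refl , h₂ , _) =
    ≤-trans (≤-reflexive (sym (length-map proj₁ X)))
      (free (symbols-of-windows q Us clash X⊆) (subst (λ z → Formation inc (2 + s) z _) (proj₁-annotate _ B) (formation-proj₁ (2 + s) f)))
    where
    clash : NoClash X
    clash {x} {o} {o′} i j = windows-ordered B _ x o o′ B₁ (B₃ ++ B₄) eq (All.lookup h₁ i)
      (occurs-++ˡ incʷ B₃ B₄ {x , o′} (All.lookup h₂ j))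

  quot : List E → A → ℕ
  quot B x = occ inc B x / K

  windows-rich : ∀ B Us → All (λ u → k < occ incʷ (annotate (λ _ → 0) B) u) (allWindows (quot B) Us)
  windows-rich B []       = []
  windows-rich B (x ∷ Us) = Allₚ.++⁺ (All.map full (All-windows x (quot B x))) (windows-rich B Us)
    where
    full : ∀ {u} → proj₁ u ≡ x × proj₂ u + K ≤ quot B x * K → k < occ incʷ (annotate (λ _ → 0) B) u
    full {_ , o} (refl , le) = +-cancelˡ-≤ o _ _ (window-full B _ x o (≤-trans le (m/n*n≤m (occ inc B x) K)))

  length-allWindows : ∀ B Us → sum (map (occ inc B) Us) ≤ K * (length (allWindows (quot B) Us) + length Us)
  length-allWindows B [] = z≤n
  length-allWindows B (x ∷ Us) = begin
    occ inc B x + sum (map (occ inc B) Us)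
      ≤⟨ +-mono-≤ one (length-allWindows B Us) ⟩
    (K + quot B x * K) + K * (L + length Us)
      ≡⟨ lem K (quot B x) L (length Us) ⟩
    K * (quot B x + L + suc (length Us))
      ≡⟨ cong (λ z → K * (z + suc (length Us))) (sym (trans (length-++ (windows x (quot B x))) (cong (_+ L) (length-windows x _)))) ⟩
    K * (length (allWindows (quot B) (x ∷ Us)) + suc (length Us)) ∎
    where
    open ≤-Reasoning
    L = length (allWindows (quot B) Us)
    lem : ∀ K q L n → (K + q * K) + K * (L + n) ≡ K * (q + L + suc n)
    lem = solve-∀
    one : occ inc B x ≤ K + quot B x * K
    one = ≤-trans (≤-reflexive (m≡m%n+[m/n]*n (occ inc B x) K)) (+-monoˡ-≤ _ (<⇒≤ (m%n<n (occ inc B x) K)))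

-- The full windows are the symbols with more than k occurrences; the summand `length Us` pays for
-- the incomplete window that each original symbol may leave over.
occurrences-bound : ∀ {r k s w M} → Bounded r k (2 + s) w M → {A E : Set} (inc : E → A → Bool) (B : List E) (Us : List A) →
  length B ≤ M → Free inc r (2 + s) B Us → sum (map (occ inc B) Us) ≤ suc k * (w * length B + length Us)
occurrences-bound {k = k} {w = w} b inc B Us l free = ≤-trans (length-allWindows B Us)
  (*-monoʳ-≤ (suc k) (+-monoˡ-≤ (length Us) (≤-trans
    (symbols≤ b incʷ (annotate (λ _ → 0) B) (allWindows (quot B) Us) (≤-trans (≤-reflexive len) l)
      (windows-rich B Us) (free-windows (quot B) Us B free))
    (*-monoʳ-≤ w (≤-trans (m∸n≤m _ 1) (≤-reflexive len))))))
  where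
  open Windows inc k
  len = length-annotate (λ _ → 0) B

does⁺ : {P : Set} (d : Dec P) → P → T (does d)
does⁺ (yes _) p = tt
does⁺ (no ¬p) p = ¬p p

does⁻ : {P : Set} (d : Dec P) → T (does d) → P
does⁻ (yes p) t = p

count-mono : {A : Set} (p q : A → Bool) (Us : List A) → (∀ x → T (p x) → T (q x)) → count p Us ≤ count q Us
count-mono p q [] h = z≤n
count-mono p q (x ∷ Us) h = +-mono-≤ (lem (p x) (q x) (h x)) (count-mono p q Us h)
  where
  lem : ∀ a b → (T a → T b) → bit a ≤ bit b
  lem false b     h = z≤n
  lem true  true  h = ≤-refl
  lem true  false h = ⊥-elim (h tt)

count-strict : {A : Set} (p q : A → Bool) {Us : List A} {y : A} → (∀ x → T (p x) → T (q x)) → y ∈ Us → T (q y) → ¬ T (p y) →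
  suc (count p Us) ≤ count q Us
count-strict p q {x ∷ Us} h (here refl) ty ¬ty with p x | q x
... | true  | _     = ⊥-elim (¬ty tt)
... | false | false = ⊥-elim ty
... | false | true  = s≤s (count-mono p q Us h)
count-strict p q {x ∷ Us} h (there i) ty ¬ty = ≤-trans (≤-reflexive (sym (+-suc (bit (p x)) _)))
  (+-mono-≤ (lem (p x) (q x) (h x)) (count-strict p q h i ty ¬ty))
  where
  lem : ∀ a b → (T a → T b) → bit a ≤ bit b
  lem false b     h = z≤n
  lem true  true  h = ≤-refl
  lem true  false h = ⊥-elim (h tt)

unique-⊆ : {A : Set} {X Y : List A} → X ⊆ Y → Unique Y → Unique X
unique-⊆ []         u        = u
unique-⊆ (_ ∷ʳ h)   (_ ∷ u)  = unique-⊆ h u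
unique-⊆ (refl ∷ h) (n ∷ u)  = All-resp-⊆ h n ∷ unique-⊆ h u

unique-shift : {A : Set} (y : A) (X₁ X₂ : List A) → Unique (X₁ ++ y ∷ X₂) → Unique (y ∷ X₁ ++ X₂)
unique-shift y []       X₂ u       = u
unique-shift y (x ∷ X₁) X₂ (n ∷ u) with unique-shift y X₁ X₂ u | All-resp-↭ (shift y X₁ X₂) n
... | n′ ∷ u′ | x≢y ∷ n″ = ((λ e → x≢y (sym e)) ∷ n′) ∷ (n″ ∷ u′)

formation-⊆ : {A E : Set} (inc : E → A → Bool) (s : ℕ) {B : List E} {X Y : List A} → X ⊆ Y → Formation inc s B Y → Formation inc s B X
formation-⊆ inc zero    h f = tt
formation-⊆ inc (suc s) h (B₁ , B₂ , eq , a , f) = B₁ , B₂ , eq , All-resp-⊆ h a , formation-⊆ inc s h f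

-- Cutting a sequence at first and last occurrences

module Sequences {A : Set} (_≟_ : DecidableEquality A) where

  open DecMembership _≟_ using (_∈?_)

  letter : A → A → Bool
  letter y x = does (y ≟ x)

  occ⇒∈ : ∀ S {x} → 0 < occ letter S x → x ∈ S
  occ⇒∈ (y ∷ S) {x} h with y ≟ x
  ... | yes refl = here refl
  ... | no  _    = there (occ⇒∈ S h)

  ∈⇒occ : ∀ {S x} → x ∈ S → 0 < occ letter S x
  ∈⇒occ {y ∷ S} (here refl) = ≤-trans (T⇒0<bit (does⁺ (y ≟ y) refl)) (m≤m+n _ _)
  ∈⇒occ {y ∷ S} (there h)   = ≤-trans (∈⇒occ h) (m≤n+m _ (bit (letter y _)))

  LocallyUnique : ℕ → List A → Set
  LocallyUnique r S = ∀ P g Q → S ≡ P ++ (g ++ Q) → length g ≤ r → Unique g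

  -- Membership in S is required separately because a formation with no permutations says nothing
  -- about X; a stretch between cuts uses it to find X before and after itself.
  FormationFreeSeq : ℕ → ℕ → List A → Set
  FormationFreeSeq r s S = ∀ X → Unique X → length X ≡ r → All (_∈ S) X → ¬ Formation letter s S X

  LengthBound : (r s c n : ℕ) → Set
  LengthBound r s c n = ∀ S Us → Unique Us → All (_∈ Us) S → length Us ≤ n → LocallyUnique r S → FormationFreeSeq r s S →
    length S ≤ c * length Us

  -- By sparseness the first r letters would be distinct, and `form` would make them a formation; so
  -- S has fewer than r letters.
  length-bound-small : ∀ r s n → (∀ S X → All (_∈ S) X → Formation letter s S X) → LengthBound r s r n
  length-bound-small r s n form [] Us u a l lu ff = z≤n
  length-bound-small r s n form S@(_ ∷ _) (_ ∷ Us) u a l lu ff with r ≤? length S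
  ... | no ¬p = ≤-trans (<⇒≤ (≰⇒> ¬p)) (m≤m*n r (suc (length Us)))
  ... | yes p = ⊥-elim (ff (take r S) (lu [] (take r S) (drop r S) (sym (take++drop≡id r S)) (≤-reflexive len)) len inS (form S _ inS))
    where
    len = trans (length-take r S) (m≤n⇒m⊓n≡m p)
    inS : All (_∈ S) (take r S)
    inS = All-resp-⊆ (take-⊆ r S) (All.tabulate id)
  length-bound-small r s n form (x ∷ S) [] u (() ∷ a) l lu ff

  length-bound-0 : ∀ r n → LengthBound r 0 r n
  length-bound-0 r n = length-bound-small r 0 n (λ _ _ _ → tt)

  length-bound-1 : ∀ r n → LengthBound r 1 r n
  length-bound-1 r n = length-bound-small r 1 n (λ S X h → S , [] , sym (++-identityʳ S) , All.map ∈⇒occ h , tt)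

  data Cut (P : List A) : List A → List (List A) → Set where
    end  : Cut P [] []
    step : ∀ {g y S gs} → All (_∈ P) g → All (_∈ y ∷ S) g → (y ∉ P ++ g) ⊎ (y ∉ S) → Cut (P ++ (g ++ [ y ])) S gs →
      Cut P (g ++ y ∷ S) (g ∷ [ y ] ∷ gs)

  cut-cons : ∀ {P y S gs} → y ∈ P → y ∈ S → Cut (P ++ [ y ]) S gs → ∃[ gs′ ] Cut P (y ∷ S) gs′
  cut-cons y∈P () end
  cut-cons {P} {y} y∈P y∈S (step {g} {z} {S} g∈P g∈S mark c) = _ ,
    step (y∈P ∷ All.map old g∈P) (later (∈-++⁻ g y∈S) ∷ g∈S) (mark′ mark) (subst (λ z → Cut z _ _) (++-assoc P [ y ] _) c)
    where
    old : ∀ {x} → x ∈ P ++ [ y ] → x ∈ P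
    old i with ∈-++⁻ P i
    ... | inj₁ j           = j
    ... | inj₂ (here refl) = y∈P
    later : y ∈ g ⊎ y ∈ z ∷ S → y ∈ z ∷ S
    later (inj₁ i) = All.lookup g∈S i
    later (inj₂ i) = i
    mark′ : (z ∉ (P ++ [ y ]) ++ g) ⊎ (z ∉ S) → (z ∉ P ++ (y ∷ g)) ⊎ (z ∉ S)
    mark′ (inj₁ n) = inj₁ (λ i → n (subst (z ∈_) (sym (++-assoc P [ y ] g)) i))
    mark′ (inj₂ n) = inj₂ n

  -- The letters that are a first or a last occurrence become groups of their own; every other letter has the
  -- same symbol both before and after its group.
  cut : ∀ P S → ∃[ gs ] Cut P S gs
  cut P [] = [] , end
  cut P (y ∷ S) with cut (P ++ [ y ]) S | y ∈? P | y ∈? S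
  ... | gs , c | yes p | yes q = cut-cons p q c
  ... | gs , c | no ¬p | _     = _ , step [] [] (inj₁ (λ i → ¬p (subst (y ∈_) (++-identityʳ P) i))) c
  ... | gs , c | yes _ | no ¬q = _ , step [] [] (inj₂ ¬q) c

  cut-concat : ∀ {P S gs} → Cut P S gs → concat gs ≡ S
  cut-concat end = refl
  cut-concat (step {g} {y} _ _ _ c) = cong (λ z → g ++ y ∷ z) (cut-concat c)

  Good : List A → List A → Set
  Good S g = ∃[ P ] ∃[ Q ] (S ≡ P ++ (g ++ Q) × (length g ≤ 1 ⊎ (All (_∈ P) g × All (_∈ Q) g)))

  cut-good : ∀ {P S gs} → Cut P S gs → All (Good (P ++ S)) gs
  cut-good end = []
  cut-good {P} (step {g} {y} {S} g∈P g∈S _ c) =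
    (P , y ∷ S , refl , inj₂ (g∈P , g∈S)) ∷
    (P ++ g , S , sym (++-assoc P g (y ∷ S)) , inj₁ ≤-refl) ∷
    subst (λ z → All (Good z) _) (trans (++-assoc P (g ++ [ y ]) S) (cong (P ++_) (++-assoc g [ y ] S))) (cut-good c)

  -- Symbols not yet met plus symbols still to come. A first occurrence lowers one count, a last
  -- occurrence the other, and each cut creates two groups: at most 4 n groups in all.
  potential : List A → List A → List A → ℕ
  potential Us P S = count (λ x → does (¬? (x ∈? P))) Us + count (λ x → does (x ∈? S)) Us

  cut-length : ∀ Us {P S gs} → All (_∈ Us) S → Cut P S gs → length gs ≤ 2 * potential Us P S
  cut-length Us a end = z≤n
  cut-length Us {P} a (step {g} {y} {S} _ _ mark c) = ≤-trans (+-monoʳ-≤ 2 (cut-length Us (All.tail a′) c))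
    (≤-trans (≤-reflexive (sym (*-suc 2 _))) (*-monoʳ-≤ 2 (decrease mark)))
    where
    a′ : All (_∈ Us) (y ∷ S)
    a′ = Allₚ.++⁻ʳ g a
    P′ = P ++ (g ++ [ y ])
    new : ∀ x → T (does (¬? (x ∈? P′))) → T (does (¬? (x ∈? P)))
    new x t = does⁺ (¬? (x ∈? P)) (λ i → does⁻ (¬? (x ∈? P′)) t (∈-++⁺ˡ i))
    left : ∀ x → T (does (x ∈? S)) → T (does (x ∈? (g ++ y ∷ S)))
    left x t = does⁺ (x ∈? (g ++ y ∷ S)) (∈-++⁺ʳ g (there (does⁻ (x ∈? S) t)))
    decrease : (y ∉ P ++ g) ⊎ (y ∉ S) → suc (potential Us P′ S) ≤ potential Us P (g ++ y ∷ S)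
    decrease (inj₁ n) = +-mono-≤ (count-strict _ _ new (All.head a′)
        (does⁺ (¬? (y ∈? P)) (λ i → n (∈-++⁺ˡ i)))
        (λ t → does⁻ (¬? (y ∈? P′)) t (∈-++⁺ʳ P (∈-++⁺ʳ g (here refl)))))
      (count-mono _ _ Us left)
    decrease (inj₂ n) = ≤-trans (≤-reflexive (sym (+-suc _ _))) (+-mono-≤ (count-mono _ _ Us new)
      (count-strict _ _ left (All.head a′) (does⁺ (y ∈? (g ++ y ∷ S)) (∈-++⁺ʳ g (here refl)))
        (λ t → n (does⁻ (y ∈? S) t))))

  cut-length₀ : ∀ Us {S gs} → All (_∈ Us) S → Cut [] S gs → length gs ≤ 4 * length Us
  cut-length₀ Us a c = ≤-trans (cut-length Us a c) (≤-trans
    (*-monoʳ-≤ 2 (+-mono-≤ (count≤length _ Us) (count≤length _ Us))) (≤-reflexive (lem (length Us))))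
    where
    lem : ∀ n → 2 * (n + n) ≡ 4 * n
    lem = solve-∀

  length-concat : {B : Set} (gs : List (List B)) → length (concat gs) ≡ sum (map length gs)
  length-concat []       = refl
  length-concat (g ∷ gs) = trans (length-++ g) (cong (length g +_) (length-concat gs))

  sum-bound : {B : Set} (f h : B → ℕ) (c : ℕ) (gs : List B) → All (λ g → f g ≤ c * h g) gs → sum (map f gs) ≤ c * sum (map h gs)
  sum-bound f h c [] [] = z≤n
  sum-bound f h c (g ∷ gs) (p ∷ ps) = ≤-trans (+-mono-≤ p (sum-bound f h c gs ps)) (≤-reflexive (sym (*-distribˡ-+ c (h g) _)))

  -- Each stretch is charged, with factor c, to its distinct symbols. Summed over the stretches,
  -- these are the occurrences in the contracted sequence.
  length-bound-step : ∀ {r s k w c n} → 1 ≤ c → Bounded r k (2 + s) w (4 * n) → LengthBound r s c n →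
    LengthBound r (2 + s) (c * (suc k * (w * 4 + 1))) n
  length-bound-step {r} {s} {k} {w} {c} {n} 1≤c bd ih S Us u a l lu ff with cut [] S
  ... | gs , ct = begin
    length S                                       ≡⟨ cong length (sym (cut-concat ct)) ⟩
    length (concat gs)                             ≡⟨ length-concat gs ⟩
    sum (map length gs)                            ≤⟨ sum-bound length _ c gs (All.map group (cut-good ct)) ⟩
    c * sum (map (λ g → count (merged letter g) Us) gs)    ≡⟨ cong (c *_) (double-count (merged letter) gs Us) ⟩
    c * sum (map (occ (merged letter) gs) Us)      ≤⟨ *-monoʳ-≤ c (occurrences-bound bd (merged letter) gs Us few free) ⟩
    c * (suc k * (w * length gs + length Us))
      ≤⟨ *-monoʳ-≤ c (*-monoʳ-≤ (suc k) (+-monoˡ-≤ (length Us) (*-monoʳ-≤ w (cut-length₀ Us a ct)))) ⟩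
    c * (suc k * (w * (4 * length Us) + length Us))  ≡⟨ lem c (suc k) w (length Us) ⟩
    c * (suc k * (w * 4 + 1)) * length Us ∎
    where
    open ≤-Reasoning
    lem : ∀ c k w m → c * (k * (w * (4 * m) + m)) ≡ c * (k * (w * 4 + 1)) * m
    lem = solve-∀
    few : length gs ≤ 4 * n
    few = ≤-trans (cut-length₀ Us a ct) (*-monoʳ-≤ 4 l)
    free : Free (merged letter) r (2 + s) gs Us
    free {X} X⊆ f with length X ≤? r
    ... | yes p = p
    ... | no ¬p = ⊥-elim (ff (take r X) (unique-⊆ (⊆-trans (take-⊆ r X) X⊆) u)
            (trans (length-take r X) (m≤n⇒m⊓n≡m (<⇒≤ (≰⇒> ¬p)))) inS f′)
      where
      f′ : Formation letter (2 + s) S (take r X)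
      f′ = subst (λ z → Formation letter (2 + s) z (take r X)) (cut-concat ct)
             (formation-⊆ letter (2 + s) (take-⊆ r X) (formation-concat letter (2 + s) f))
      inS : All (_∈ S) (take r X)
      inS with f′
      ... | B₁ , B₂ , refl , h , _ = All.map (λ p → ∈-++⁺ˡ (occ⇒∈ B₁ p)) h
    group : ∀ {g} → Good S g → length g ≤ c * count (merged letter g) Us
    group {[]} _ = z≤n
    group {y ∷ []} (P , Q , refl , _) = *-mono-≤ 1≤c (Any⇒1≤count (here′ (All.lookup a (∈-++⁺ʳ P (here refl)))))
      where
      here′ : ∀ {Us} → y ∈ Us → Any (T ∘ merged letter (y ∷ [])) Us
      here′ (here refl) = here (<⇒<ᵇ (∈⇒occ {y ∷ []} (here refl)))
      here′ (there i)   = there (here′ i)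
    group {y ∷ z ∷ g} (P , Q , eq , inj₁ (s≤s ()))
    group {g@(_ ∷ _ ∷ _)} (P , Q , refl , inj₂ (g∈P , g∈Q)) = ≤-trans
      (ih g Ug (Uniqueₚ.filter⁺ (T? ∘ merged letter g) u)
        (All.tabulate (λ {x} i → ∈-filter⁺ (T? ∘ merged letter g) (All.lookup a (∈-++⁺ʳ P (∈-++⁺ˡ i))) (<⇒<ᵇ (∈⇒occ i))))
        (≤-trans (≤-trans (≤-reflexive (sym (count≡length-filter _ Us))) (count≤length _ Us)) l)
        (λ P′ h Q′ eq → lu (P ++ P′) h (Q′ ++ Q)
          (trans (cong (λ z → P ++ (z ++ Q)) eq) (trans (cong (P ++_) (trans (++-assoc P′ (h ++ Q′) Q) (cong (P′ ++_) (++-assoc h Q′ Q)))) (sym (++-assoc P P′ _)))))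
        λ X uX lX X∈g f → ff X uX lX (All.map (λ i → ∈-++⁺ʳ P (∈-++⁺ˡ i)) X∈g)
          (formation-cons letter (1 + s) P (All.map (λ i → ∈⇒occ (All.lookup g∈P i)) X∈g)
            (formation-snoc letter s Q (All.map (λ i → ∈⇒occ (All.lookup g∈Q i)) X∈g) f)))
      (≤-reflexive (cong (c *_) (sym (count≡length-filter (merged letter g) Us))))
      where
      Ug = filter (T? ∘ merged letter g) Us

  -- The first occurrences in L of the symbols of X form the permutation. This restores the order
  -- that block formations ignore.
  permutation-within : ∀ L X → Unique X → All (_∈ L) X → ∃[ P ] (P ↭ X × P ⊆ L)
  permutation-within [] [] u a = [] , ↭-refl , []
  permutation-within [] (x ∷ X) u (() ∷ a)
  permutation-within (y ∷ L) X u a with y ∈? X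
  ... | no ¬p with permutation-within L X u (All.tabulate λ {x} i → later x i (All.lookup a i))
    where
    later : ∀ x → x ∈ X → x ∈ y ∷ L → x ∈ L
    later x i (here refl) = ⊥-elim (¬p i)
    later x i (there j)   = j
  ...   | P , perm , sub = P , perm , y ∷ʳ sub
  permutation-within (y ∷ L) X u a | yes p with ∈-∃++ p
  ... | X₁ , X₂ , refl with unique-shift y X₁ X₂ u
  ...   | n ∷ u′ with permutation-within L (X₁ ++ X₂) u′ (All.tabulate λ {x} i → later x i (All.lookup (All-resp-↭ (shift y X₁ X₂) a) (there i)))
    where
    later : ∀ x → x ∈ X₁ ++ X₂ → x ∈ y ∷ L → x ∈ L
    later x i (here refl) = ⊥-elim (All.lookup n i refl)
    later x i (there j)   = j
  ...     | P , perm , sub = y ∷ P , ↭-trans (prep y perm) (↭-sym (shift y X₁ X₂)) , refl ∷ sub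

  permutations-of-formation : ∀ s S X → Unique X → Formation letter s S X →
    ∃[ Ps ] (length Ps ≡ s × All (_↭ X) Ps × concat Ps ⊆ S)
  permutations-of-formation zero    S X u f = [] , refl , [] , minimum S
  permutations-of-formation (suc s) S X u (B₁ , B₂ , refl , h , f)
    with permutation-within B₁ X u (All.map (occ⇒∈ B₁) h) | permutations-of-formation s B₂ X u f
  ... | P , perm , sub | Ps , len , perms , subs = P ∷ Ps , cong suc len , perm ∷ perms , ++⁺ sub subs

open Sequences

sparse-tail : ∀ {n} r (P : List (Fin n)) {S} → Sparse r (P ++ S) → Sparse r S
sparse-tail r []      h = h
sparse-tail r (x ∷ P) h = sparse-tail r P (λ i j lt lt′ → h (Fin.suc i) (Fin.suc j) (s≤s lt) (s≤s lt′))

sparse-prefix : ∀ {n} r (g Q : List (Fin n)) → Sparse r (g ++ Q) → length g ≤ r → Unique g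
sparse-prefix r [] Q h l = []
sparse-prefix (suc r) (x ∷ g) Q h (s≤s l) =
  distinct g r (λ j lt → h Fin.zero (Fin.suc j) (s≤s z≤n) (s≤s lt)) l ∷
  sparse-prefix (suc r) g Q (sparse-tail (suc r) [ x ] h) (≤-trans l (n≤1+n r))
  where
  distinct : ∀ g m → (∀ (j : Fin (length (g ++ Q))) → toℕ j < m → x ≢ lookup (g ++ Q) j) → length g ≤ m → All (x ≢_) g
  distinct [] m h l = []
  distinct (y ∷ g) (suc m) h (s≤s l) = h Fin.zero (s≤s z≤n) ∷ distinct g m (λ j lt → h (Fin.suc j) (s≤s lt)) l

formation-free-length : ∀ {n r s c} (S : List (Fin n)) → LengthBound (Data.Fin._≟_) r s c n → FormationFree r s S → length S ≤ c * n
formation-free-length {n} {r} {s} {c} S lb (sp , ff) = ≤-trans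
  (lb S (allFin n) (Uniqueₚ.allFin⁺ n) (All.tabulate λ {x} _ → ∈-allFin x) (≤-reflexive len)
    (λ { P g Q refl l → sparse-prefix r g Q (sparse-tail r P sp) l })
    (λ X u l _ f → ff (X , l , u , permutations-of-formation (Data.Fin._≟_) s S X u f)))
  (≤-reflexive (cong (c *_) len))
  where
  len : length (allFin n) ≡ n
  len = length-tabulate id

-- Growth of the multiplicities

-- The parameter d stands for α(n) − 2.
record Below (e : ℕ) (f : ℕ → ℕ) : Set where
  constructor below
  field
    factor : ℕ
    bound  : ∀ d → f d ≤ 2 ^ (factor * (2 + d) ^ e)

^-distribʳ-* : ∀ e a b → (a * b) ^ e ≡ a ^ e * b ^ e
^-distribʳ-* zero    a b = refl
^-distribʳ-* (suc e) a b = trans (cong (a * b *_) (^-distribʳ-* e a b)) (lem a b (a ^ e) (b ^ e))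
  where
  lem : ∀ a b c d → a * b * (c * d) ≡ a * c * (b * d)
  lem = solve-∀

below-≤ : ∀ {e f g} → (∀ d → f d ≤ g d) → Below e g → Below e f
below-≤ h (below C b) = below C λ d → ≤-trans (h d) (b d)

below-weaken : ∀ {e e′ f} → e ≤ e′ → Below e f → Below e′ f
below-weaken h (below C b) = below C λ d → ≤-trans (b d) (^-monoʳ-≤ 2 (*-monoʳ-≤ C (^-monoʳ-≤ (2 + d) h)))

below-const : ∀ c {e} → Below e (λ _ → c)
below-const c {e} = below c λ d → ≤-trans (<⇒≤ (n<2^n c)) (^-monoʳ-≤ 2 (≤-trans (≤-reflexive (sym (*-identityʳ c))) (*-monoʳ-≤ c (m^n>0 (2 + d) e))))

below-* : ∀ {e f g} → Below e f → Below e g → Below e (λ d → f d * g d)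
below-* {e} (below C b) (below C′ b′) = below (C + C′) λ d → ≤-trans (*-mono-≤ (b d) (b′ d)) (≤-reflexive
  (trans (sym (^-distribˡ-+-* 2 (C * (2 + d) ^ e) (C′ * (2 + d) ^ e))) (cong (2 ^_) (sym (*-distribʳ-+ ((2 + d) ^ e) C C′)))))

suc≤2* : ∀ {n} → 1 ≤ n → suc n ≤ 2 * n
suc≤2* {n} h = ≤-trans (+-monoˡ-≤ n h) (≤-reflexive (cong (n +_) (sym (+-identityʳ n))))

below-suc : ∀ {e f} → Below e f → Below e (λ d → suc (f d))
below-suc {e} {f} (below C b) = below-≤ {g = λ d → 2 * 2 ^ (C * (2 + d) ^ e)}
  (λ d → ≤-trans (s≤s (b d)) (suc≤2* (m^n>0 2 (C * (2 + d) ^ e)))) (below-* (below-const 2) (below C λ d → ≤-refl))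

below-8^ : ∀ m → Below 1 (λ d → 8 ^ (m + d))
below-8^ m = below (3 * suc m) λ d → ≤-trans (≤-reflexive (^-*-assoc 2 3 (m + d)))
  (^-monoʳ-≤ 2 (≤-trans (m≤m+n (3 * (m + d)) _) (≤-reflexive (sym (lem m d)))))
  where
  lem : ∀ m d → 3 * suc m * ((2 + d) * 1) ≡ 3 * (m + d) + (6 + 3 * m + 3 * m * d)
  lem = solve-∀

rich-mono : ∀ u d → rich u d ≤ rich (suc u) d
rich-mono zero    d       = s≤s z≤n
rich-mono (suc u) zero    = ≤-trans (m≤m+n (rich (suc u) 0) _) (m≤m+n _ (thr u))
rich-mono (suc u) (suc d) = m≤m+n _ _

-- Monotonicity in u bounds each of the two summands R_(s-1) by three times the product, so the
-- product formula alone holds up to the factor 3 + 3 + 1.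
rich-suc≤ : ∀ u d → rich (2 + u) (suc d) ≤ 7 * (rich u (suc d) * rich (2 + u) d)
rich-suc≤ u d = ≤-trans (+-mono-≤ (three u) (+-monoˡ-≤ _ (three u))) (≤-reflexive (lem (rich u (suc d) * rich (2 + u) d)))
  where
  lem : ∀ p → 3 * p + (3 * p + p) ≡ 7 * p
  lem = solve-∀
  three : ∀ u → rich (suc u) (suc d) ≤ 3 * (rich u (suc d) * rich (2 + u) d)
  three zero    = ≤-trans (n≤1+n 2) (*-monoʳ-≤ 3 {1} (≤-trans (1≤rich 2 d) (≤-reflexive (sym (*-identityˡ _)))))
  three (suc u) = ≤-trans (+-mono-≤ R≤ (+-mono-≤ R≤ (*-mono-≤ (rich-mono u (suc d)) (rich-mono (2 + u) d)))) (≤-reflexive (lem₂ (rich (suc u) (suc d) * rich (3 + u) d)))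
    where
    R≤ : rich (suc u) (suc d) ≤ rich (suc u) (suc d) * rich (3 + u) d
    R≤ = ≤-trans (≤-reflexive (sym (*-identityʳ _))) (*-monoʳ-≤ (rich (suc u) (suc d)) (1≤rich (3 + u) d))
    lem₂ : ∀ p → p + (p + p) ≡ 3 * p
    lem₂ = solve-∀

7*≤2^ : ∀ {x y i j} → x ≤ 2 ^ i → y ≤ 2 ^ j → 7 * (x * y) ≤ 2 ^ (3 + (i + j))
7*≤2^ {x} {y} {i} {j} hx hy = ≤-trans (*-mono-≤ (n≤1+n 7) (*-mono-≤ hx hy))
  (≤-reflexive (trans (cong (8 *_) (sym (^-distribˡ-+-* 2 i j))) (sym (^-distribˡ-+-* 2 3 (i + j)))))

-- A crude bound without the constant 1 / t!, for the factors that end up in the error terms.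
rich-below : ∀ u → Below ⌊ u /2⌋ (rich u)
rich-below zero          = below-const 1
rich-below (suc zero)    = below-const 2
rich-below (suc (suc u)) with rich-below u
... | below C b = below C′ go
  where
  e = ⌊ u /2⌋
  C′ = rich (2 + u) 0 + 3 + C
  go : ∀ d → rich (2 + u) d ≤ 2 ^ (C′ * (2 + d) ^ suc e)
  go zero = ≤-trans (<⇒≤ (n<2^n _)) (^-monoʳ-≤ 2 (≤-trans (≤-trans (m≤m+n _ 3) (m≤m+n _ C))
    (≤-trans (≤-reflexive (sym (*-identityʳ C′))) (*-monoʳ-≤ C′ (m^n>0 2 (suc e))))))
  go (suc d) = ≤-trans (rich-suc≤ u d) (≤-trans (7*≤2^ {i = C * X} {j = C′ * (2 + d) ^ suc e} (b (suc d)) (go d)) (^-monoʳ-≤ 2 exponent))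
    where
    open ≤-Reasoning
    X = (3 + d) ^ e
    lem : ∀ a C X d → 3 * X + (C * X + (a + 3 + C) * ((2 + d) * X)) + a * X ≡ (a + 3 + C) * ((3 + d) * X)
    lem = solve-∀
    exponent : 3 + (C * X + C′ * (2 + d) ^ suc e) ≤ C′ * (3 + d) ^ suc e
    exponent = begin
      3 + (C * X + C′ * ((2 + d) * (2 + d) ^ e))
        ≤⟨ +-mono-≤ {3} {3 * X} (*-monoʳ-≤ 3 {1} (m^n>0 (3 + d) e)) (+-monoʳ-≤ (C * X) (*-monoʳ-≤ C′ (*-monoʳ-≤ (2 + d) (^-monoˡ-≤ e (n≤1+n (2 + d)))))) ⟩
      3 * X + (C * X + C′ * ((2 + d) * X))   ≤⟨ m≤m+n _ _ ⟩
      3 * X + (C * X + C′ * ((2 + d) * X)) + rich (2 + u) 0 * X   ≡⟨ lem (rich (2 + u) 0) C X d ⟩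
      C′ * ((3 + d) * X) ∎

bernoulli : ∀ n y → y ^ suc n + suc n * y ^ n ≤ suc y ^ suc n
bernoulli zero    y = ≤-reflexive (lem y)
  where
  lem : ∀ y → y * 1 + 1 * 1 ≡ suc y * 1
  lem = solve-∀
bernoulli (suc n) y = ≤-trans (m≤m+n _ (suc n * y ^ n)) (≤-trans (≤-reflexive (lem y n (y ^ n))) (*-monoʳ-≤ (suc y) (bernoulli n y)))
  where
  lem : ∀ y n p → y * (y * p) + (2 + n) * (y * p) + suc n * p ≡ suc y * (y * p + suc n * p)
  lem = solve-∀

power-gap : ∀ i z b → 1 ≤ z → z ^ suc i + b ≤ (z + b) ^ suc i
power-gap i z b 1≤z = begin
  z * z ^ i + b           ≤⟨ +-monoʳ-≤ (z * z ^ i) (≤-trans (≤-reflexive (sym (*-identityʳ b))) (*-monoʳ-≤ b (m^n>0 z {{>-nonZero 1≤z}} i))) ⟩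
  z * z ^ i + b * z ^ i   ≡⟨ sym (*-distribʳ-+ (z ^ i) z b) ⟩
  (z + b) * z ^ i         ≤⟨ *-monoʳ-≤ (z + b) (^-monoˡ-≤ i (m≤m+n z b)) ⟩
  (z + b) * (z + b) ^ i ∎
  where open ≤-Reasoning

-- The exponents (d + a) ^ t are chosen so that their differences in d absorb both the exponent of the lower
-- family and the factors 7.
factorial-power-bound : (B : ℕ → ℕ) → (∀ d → 2 ≤ B d) → (∀ d → B d ≤ B (suc d)) → (Q : ℕ → ℕ → ℕ) →
  (∀ i d → Q (suc i) (suc d) ≤ 7 * (Q i (suc d) * Q (suc i) d)) → ∃[ a ] (∀ d → Q 0 d ≤ B d ^ (d + a)) →
  ∀ i → ∃[ a ] (∀ d → Q i d ^ (suc i !) ≤ B d ^ ((d + a) ^ suc i))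
factorial-power-bound B 2≤B B≤ Q Q≤ (a , h) zero = a , λ d →
  ≤-trans (≤-reflexive (*-identityʳ _)) (≤-trans (h d) (≤-reflexive (cong (B d ^_) (sym (*-identityʳ (d + a))))))
factorial-power-bound B 2≤B B≤ Q Q≤ h₀ (suc i) with factorial-power-bound B 2≤B B≤ Q Q≤ h₀ i
... | a , h = a′ , go
  where
  n = suc i
  t = suc n
  F = t !
  -- The second summand starts the induction at d = 0, the first pays for `7 ^ F` in each step. The
  -- shift `suc a` makes y equal to z + b, so that Bernoulli's surplus t * y ^ n covers both t * z ^
  -- n and b * t.
  b = 3 * F + Q (suc i) 0 ^ F
  a′ = suc a + b
  go : ∀ d → Q (suc i) d ^ F ≤ B d ^ ((d + a′) ^ t)
  go zero = ≤-trans (<⇒≤ (n<2^n _)) (≤-trans (^-monoˡ-≤ (Q (suc i) 0 ^ F) (2≤B 0)) (^-monoʳ-≤ (B 0) {{>-nonZero (≤-trans (s≤s z≤n) (2≤B 0))}}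
    (≤-trans (m≤n+m _ (3 * F)) (≤-trans (m≤n+m b (suc a)) (≤-trans (≤-reflexive (sym (^-identityʳ a′))) (^-monoʳ-≤ a′ {1} {t} (s≤s z≤n)))))))
  go (suc d) = begin
    Q (suc i) (suc d) ^ F         ≤⟨ ^-monoˡ-≤ F (Q≤ i d) ⟩
    (7 * (q * p)) ^ F             ≡⟨ trans (^-distribʳ-* F 7 (q * p)) (cong (7 ^ F *_) (^-distribʳ-* F q p)) ⟩
    7 ^ F * (q ^ F * p ^ F)       ≤⟨ *-mono-≤ seven (*-mono-≤ lower prev) ⟩
    B′ ^ (3 * F) * (B′ ^ (z ^ n * t) * B′ ^ (y ^ t))
      ≡⟨ trans (cong (B′ ^ (3 * F) *_) (sym (^-distribˡ-+-* B′ (z ^ n * t) (y ^ t)))) (sym (^-distribˡ-+-* B′ (3 * F) (z ^ n * t + y ^ t))) ⟩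
    B′ ^ (3 * F + (z ^ n * t + y ^ t))   ≤⟨ ^-monoʳ-≤ B′ {{>-nonZero (≤-trans (s≤s z≤n) (2≤B (suc d)))}} exponent ⟩
    B′ ^ (suc y ^ t) ∎
    where
    open ≤-Reasoning
    q = Q i (suc d)
    p = Q (suc i) d
    B′ = B (suc d)
    z = suc d + a
    y = d + a′
    seven : 7 ^ F ≤ B′ ^ (3 * F)
    seven = ≤-trans (^-monoˡ-≤ F (n≤1+n 7)) (≤-trans (≤-reflexive (^-*-assoc 2 3 F)) (^-monoˡ-≤ (3 * F) (2≤B (suc d))))
    lower : q ^ F ≤ B′ ^ (z ^ n * t)
    lower = ≤-trans (≤-reflexive (trans (cong (q ^_) (*-comm t (n !))) (sym (^-*-assoc q (n !) t))))
      (≤-trans (^-monoˡ-≤ t (h (suc d))) (≤-reflexive (^-*-assoc B′ (z ^ n) t)))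
    prev : p ^ F ≤ B′ ^ (y ^ t)
    prev = ≤-trans (go d) (^-monoˡ-≤ (y ^ t) (B≤ d))
    y≡ : y ≡ z + b
    y≡ = lem d a b
      where
      lem : ∀ d a b → d + (suc a + b) ≡ suc d + a + b
      lem = solve-∀
    exponent : 3 * F + (z ^ n * t + y ^ t) ≤ suc y ^ t
    exponent = begin
      3 * F + (z ^ n * t + y ^ t)   ≤⟨ +-monoˡ-≤ _ (≤-trans (m≤m+n (3 * F) _) (m≤m*n b t)) ⟩
      b * t + (z ^ n * t + y ^ t)   ≡⟨ lem b t (z ^ n) (y ^ t) ⟩
      y ^ t + t * (z ^ n + b)       ≤⟨ +-monoʳ-≤ (y ^ t) (*-monoʳ-≤ t (≤-trans (power-gap i z b (s≤s z≤n)) (≤-reflexive (cong (_^ n) (sym y≡))))) ⟩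
      y ^ t + t * y ^ n             ≤⟨ bernoulli n y ⟩
      suc y ^ t ∎
      where
      lem : ∀ b t x w → b * t + (x * t + w) ≡ w + t * (x + b)
      lem = solve-∀

power-shift : ∀ a t → ∃[ C ] (∀ D → 1 ≤ D → (D + a) ^ suc t ≤ D ^ suc t + C * D ^ t)
power-shift a zero = a , λ D _ → ≤-reflexive (lem D a)
  where
  lem : ∀ D a → (D + a) * 1 ≡ D * 1 + a * 1
  lem = solve-∀
power-shift a (suc t) with power-shift a t
... | C , h = C + a + a * C , λ D 1≤D → let P = D ^ t in begin
  (D + a) * (D + a) ^ suc t                       ≤⟨ *-monoʳ-≤ (D + a) (h D 1≤D) ⟩
  (D + a) * (D * P + C * P)                       ≡⟨ lem D a C P ⟩
  D * (D * P) + ((C + a) * (D * P) + a * C * P)   ≤⟨ +-monoʳ-≤ (D * (D * P)) (+-monoʳ-≤ ((C + a) * (D * P)) (*-monoʳ-≤ (a * C) (m≤n*m P D {{>-nonZero 1≤D}}))) ⟩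
  D * (D * P) + ((C + a) * (D * P) + a * C * (D * P))   ≡⟨ cong (D * (D * P) +_) (sym (*-distribʳ-+ (D * P) (C + a) (a * C))) ⟩
  D * (D * P) + (C + a + a * C) * (D * P) ∎
  where
  open ≤-Reasoning
  lem : ∀ D a C P → (D + a) * (D * P + C * P) ≡ D * (D * P) + ((C + a) * (D * P) + a * C * P)
  lem = solve-∀

split-power : ∀ {L c n f k X Y} F → L ≤ c * n → c ≤ f * k → f ^ F ≤ X → k ^ F ≤ Y → L ^ F ≤ n ^ F * (Y * X)
split-power {L} {c} {n} {f} {k} {X} {Y} F hL hc hX hY = begin
  L ^ F                     ≤⟨ ^-monoˡ-≤ F (≤-trans hL (*-monoˡ-≤ n hc)) ⟩
  (f * k * n) ^ F           ≡⟨ trans (^-distribʳ-* F (f * k) n) (cong (_* n ^ F) (^-distribʳ-* F f k)) ⟩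
  f ^ F * k ^ F * n ^ F     ≤⟨ *-monoˡ-≤ (n ^ F) (*-mono-≤ hX hY) ⟩
  X * Y * n ^ F             ≡⟨ trans (*-comm (X * Y) (n ^ F)) (cong (n ^ F *_) (*-comm X Y)) ⟩
  n ^ F * (Y * X) ∎
  where open ≤-Reasoning

below-^ : ∀ e (f : ℕ → ℕ) F C → (∀ d → f d ≤ 2 ^ (C * (2 + d) ^ e)) → ∀ d → f d ^ F ≤ 2 ^ (C * F * (2 + d) ^ e)
below-^ e f F C b d = ≤-trans (^-monoˡ-≤ F (b d)) (≤-reflexive (trans (^-*-assoc 2 (C * (2 + d) ^ e) F) (cong (2 ^_) (lem C ((2 + d) ^ e) F))))
  where
  lem : ∀ a b c → a * b * c ≡ a * c * b
  lem = solve-∀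

-- The constant c is split into k, whose exponent is known with its leading term, and f, which goes
-- entirely into the error term.
odd-growth : ∀ t {c f k : ℕ → ℕ} → (∀ d → c d ≤ f d * k d) → Below t f → ∃[ a ] (∀ d → k d ^ (suc t !) ≤ 2 ^ ((d + a) ^ suc t)) →
  ∃[ C ] (∀ d L n → L ≤ c d * n → L ^ (suc t !) ≤ n ^ (suc t !) * 2 ^ ((2 + d) ^ suc t + C * (2 + d) ^ t))
odd-growth t {f = f} hc (below C hf) (a , hk) with power-shift a t
... | C₁ , hs = C₁ + C * F , λ d L n hL → ≤-trans (split-power F hL (hc d) (below-^ t f F C hf d) (hk d))
  (*-monoʳ-≤ (n ^ F) (≤-trans (≤-reflexive (sym (^-distribˡ-+-* 2 ((d + a) ^ suc t) (C * F * (2 + d) ^ t))))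
    (^-monoʳ-≤ 2 (≤-trans (+-monoˡ-≤ _ (≤-trans (^-monoˡ-≤ (suc t) (+-monoˡ-≤ a (m≤n+m d 2))) (hs (2 + d) (s≤s z≤n))))
      (≤-reflexive (lem ((2 + d) ^ suc t) C₁ (C * F) ((2 + d) ^ t)))))))
  where
  F = suc t !
  lem : ∀ a b c p → a + b * p + c * p ≡ a + (b + c) * p
  lem = solve-∀

-- For the exponent t + 1, removing the shift a costs about C D ^ t log₂ D in the exponent of 2, and
-- log₂ D < D puts this into the error term.
power-log : ∀ b a t → ∃[ C ] (∀ D → 1 ≤ D → (2 ^ b * D) ^ ((D + a) ^ t) ≤ D ^ (D ^ t) * 2 ^ (C * D ^ t))
power-log b a zero = b , λ D _ → ≤-reflexive (trans (lem (2 ^ b) D) (cong (λ z → D ^ 1 * 2 ^ z) (sym (*-identityʳ b))))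
  where
  lem : ∀ x D → x * D * 1 ≡ D * 1 * x
  lem = solve-∀
power-log b a (suc t) with power-shift a t
... | C , h = b + b * C + C , λ D 1≤D → bound D 1≤D (>-nonZero 1≤D)
  where
  open ≤-Reasoning
  bound : ∀ D → 1 ≤ D → NonZero D → (2 ^ b * D) ^ ((D + a) ^ suc t) ≤ D ^ (D ^ suc t) * 2 ^ ((b + b * C + C) * D ^ suc t)
  bound D 1≤D nz = begin
    (2 ^ b * D) ^ ((D + a) ^ suc t)
      ≤⟨ ^-monoʳ-≤ (2 ^ b * D) {{>-nonZero (*-mono-≤ (m^n>0 2 b) 1≤D)}} (h D 1≤D) ⟩
    (2 ^ b * D) ^ (H + C * P)
      ≡⟨ trans (^-distribʳ-* (H + C * P) (2 ^ b) D) (cong₂ _*_ (^-*-assoc 2 b (H + C * P)) (^-distribˡ-+-* D H (C * P))) ⟩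
    2 ^ (b * (H + C * P)) * (D ^ H * D ^ (C * P))
      ≤⟨ *-mono-≤ (^-monoʳ-≤ 2 (*-monoʳ-≤ b (+-monoʳ-≤ H (*-monoʳ-≤ C P≤H)))) (*-monoʳ-≤ (D ^ H) small) ⟩
    2 ^ (b * (H + C * H)) * (D ^ H * 2 ^ (C * H))
      ≡⟨ trans (swap (2 ^ (b * (H + C * H))) (D ^ H) (2 ^ (C * H))) (cong (D ^ H *_) (sym (^-distribˡ-+-* 2 (b * (H + C * H)) (C * H)))) ⟩
    D ^ H * 2 ^ (b * (H + C * H) + C * H)
      ≡⟨ cong (λ z → D ^ H * 2 ^ z) (lem b C H) ⟩
    D ^ H * 2 ^ ((b + b * C + C) * H) ∎
    where
    P = D ^ t
    H = D ^ suc t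
    P≤H : P ≤ H
    P≤H = m≤n*m P D {{nz}}
    lem : ∀ b C H → b * (H + C * H) + C * H ≡ (b + b * C + C) * H
    lem = solve-∀
    swap : ∀ x y z → x * (y * z) ≡ y * (x * z)
    swap = solve-∀
    swap₂ : ∀ D C P → D * (C * P) ≡ C * (D * P)
    swap₂ = solve-∀
    small : D ^ (C * P) ≤ 2 ^ (C * H)
    small = ≤-trans (^-monoˡ-≤ (C * P) (<⇒≤ (n<2^n D))) (≤-reflexive (trans (^-*-assoc 2 D (C * P)) (cong (2 ^_) (swap₂ D C P))))

even-growth : ∀ t b {c f k : ℕ → ℕ} → (∀ d → c d ≤ f d * k d) → Below t f →
  ∃[ a ] (∀ d → k d ^ (t !) ≤ (2 ^ b * (2 + d)) ^ ((d + a) ^ t)) →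
  ∃[ C ] (∀ d L n → L ≤ c d * n → L ^ (t !) ≤ n ^ (t !) * ((2 + d) ^ ((2 + d) ^ t) * 2 ^ (C * (2 + d) ^ t)))
even-growth t b {f = f} hc (below C hf) (a , hk) with power-log b a t
... | C₁ , hs = C₁ + C * F , λ d L n hL → let P = (2 + d) ^ t in
  ≤-trans (split-power F hL (hc d) (below-^ t f F C hf d) (≤-trans (hk d)
    (≤-trans (^-monoʳ-≤ (2 ^ b * (2 + d)) {{>-nonZero (*-mono-≤ (m^n>0 2 b) (s≤s z≤n))}} (^-monoˡ-≤ t (+-monoˡ-≤ a (m≤n+m d 2)))) (hs (2 + d) (s≤s z≤n)))))
  (*-monoʳ-≤ (n ^ F) (≤-reflexive (trans (*-assoc ((2 + d) ^ P) _ _) (cong ((2 + d) ^ P *_)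
    (trans (sym (^-distribˡ-+-* 2 (C₁ * P) (C * F * P))) (cong (2 ^_) (sym (*-distribʳ-+ P C₁ (C * F)))))))))
  where
  F = t !

double : ℕ → ℕ
double zero    = zero
double (suc i) = suc (suc (double i))

⌊1+double/2⌋ : ∀ i → ⌊ suc (double i) /2⌋ ≡ i
⌊1+double/2⌋ zero    = refl
⌊1+double/2⌋ (suc i) = cong suc (⌊1+double/2⌋ i)

⌊double/2⌋ : ∀ i → ⌊ double i /2⌋ ≡ i
⌊double/2⌋ zero    = refl
⌊double/2⌋ (suc i) = cong suc (⌊double/2⌋ i)

opaque

  -- The factor 7 of `rich-suc≤` at every level would spoil the leading term here. The exact
  -- recursion becomes a pure doubling once 8 d + 2 a + 16 is added to absorb its linear part.
  rich-3≤ : ∃[ K ] (∀ d → rich 3 d ≤ K * 2 ^ d)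
  rich-3≤ = rich 3 0 + 2 * a + 16 , λ d → ≤-trans (≤-trans (m≤m+n _ (8 * d)) (m≤m+n _ (2 * a + 16))) (go d)
    where
    open ≤-Reasoning
    a : ℕ
    a = rich 2 0
    lem : ∀ a d x → (a + 4 * suc d) + ((a + 4 * suc d) + 2 * x) + 8 * suc d + (2 * a + 16) ≡ 2 * (x + 8 * d + (2 * a + 16))
    lem = solve-∀
    swap : ∀ x y → 2 * (x * y) ≡ x * (2 * y)
    swap = solve-∀
    go : ∀ d → rich 3 d + 8 * d + (2 * a + 16) ≤ (rich 3 0 + 2 * a + 16) * 2 ^ d
    go zero    = ≤-reflexive (lem₀ (rich 3 0) (2 * a))
      where
      lem₀ : ∀ x y → x + 0 + (y + 16) ≡ (x + y + 16) * 1
      lem₀ = solve-∀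
    go (suc d) = begin
      rich 2 (suc d) + (rich 2 (suc d) + 2 * rich 3 d) + 8 * suc d + (2 * a + 16)
        ≡⟨ cong (λ z → z + (z + 2 * rich 3 d) + 8 * suc d + (2 * a + 16)) (rich-2-linear (suc d)) ⟩
      (a + 4 * suc d) + ((a + 4 * suc d) + 2 * rich 3 d) + 8 * suc d + (2 * a + 16)   ≡⟨ lem a d (rich 3 d) ⟩
      2 * (rich 3 d + 8 * d + (2 * a + 16))   ≤⟨ *-monoʳ-≤ 2 (go d) ⟩
      2 * ((rich 3 0 + 2 * a + 16) * 2 ^ d)   ≡⟨ swap (rich 3 0 + 2 * a + 16) (2 ^ d) ⟩
      (rich 3 0 + 2 * a + 16) * 2 ^ suc d ∎

rich-odd-bound : ∀ i → ∃[ a ] (∀ d → rich (3 + double i) d ^ (suc i !) ≤ 2 ^ ((d + a) ^ suc i))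
rich-odd-bound = factorial-power-bound (λ _ → 2) (λ _ → ≤-refl) (λ _ → ≤-refl) (λ i → rich (3 + double i))
  (λ i → rich-suc≤ (3 + double i)) (first rich-3≤)
  where
  first : ∃[ K ] (∀ d → rich 3 d ≤ K * 2 ^ d) → ∃[ a ] (∀ d → rich 3 d ≤ 2 ^ (d + a))
  first (K , h) = K , λ d → ≤-trans (h d) (≤-trans (*-monoˡ-≤ (2 ^ d) (<⇒≤ (n<2^n K)))
    (≤-reflexive (trans (*-comm (2 ^ K) (2 ^ d)) (sym (^-distribˡ-+-* 2 d K)))))

opaque

  rich-2≤ : ∃[ b ] (∀ d → 7 * rich 2 (suc d) ≤ 2 ^ b * (3 + d))
  rich-2≤ = 7 * (rich 2 0 + 4) , λ d → ≤-trans (≤-reflexive (cong (7 *_) (rich-2-linear (suc d))))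
    (≤-trans (m≤m+n _ _) (≤-trans (≤-reflexive (lem (rich 2 0) d)) (*-monoˡ-≤ (3 + d) (<⇒≤ (n<2^n (7 * (rich 2 0 + 4)))))))
    where
    lem : ∀ a d → 7 * (a + 4 * suc d) + (14 * a + 7 * a * d + 56) ≡ 7 * (a + 4) * (3 + d)
    lem = solve-∀

-- The base bounds the linear `rich 2`, with the factor 7 included; `rich 4` is then at most a
-- product of about d such factors.
rich-even-bound : ∃[ b ] (∀ i → ∃[ a ] (∀ d → rich (4 + double i) d ^ (suc i !) ≤ (2 ^ b * (2 + d)) ^ ((d + a) ^ suc i)))
rich-even-bound = go rich-2≤
  where
  go : ∃[ b ] (∀ d → 7 * rich 2 (suc d) ≤ 2 ^ b * (3 + d)) →
    ∃[ b ] (∀ i → ∃[ a ] (∀ d → rich (4 + double i) d ^ (suc i !) ≤ (2 ^ b * (2 + d)) ^ ((d + a) ^ suc i)))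
  go (b , h) = b , factorial-power-bound B (λ d → *-mono-≤ (m^n>0 2 b) (s≤s (s≤s z≤n))) (λ d → *-monoʳ-≤ (2 ^ b) (n≤1+n _))
    (λ i → rich (4 + double i)) (λ i → rich-suc≤ (4 + double i)) (rich 4 0 , first)
    where
    B : ℕ → ℕ
    B d = 2 ^ b * (2 + d)
    first : ∀ d → rich 4 d ≤ B d ^ (d + rich 4 0)
    first zero = ≤-trans (<⇒≤ (n<2^n _)) (^-monoˡ-≤ (rich 4 0) (*-mono-≤ (m^n>0 2 b) (≤-refl {2})))
    first (suc d) = ≤-trans (rich-suc≤ 2 d) (≤-trans (≤-reflexive (sym (*-assoc 7 (rich 2 (suc d)) (rich 4 d))))
      (*-mono-≤ (h d) (≤-trans (first d) (^-monoˡ-≤ (d + rich 4 0) (*-monoʳ-≤ (2 ^ b) (n≤1+n (2 + d)))))))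

-- Collecting the constants

module _ (r : ℕ) where

  weight : ℕ → ℕ → ℕ
  weight zero          d = r
  weight (suc zero)    d = r
  weight (suc (suc u)) d = wt r (2 + u) d * 5 ^ (2 + u)

  bounded-level : ∀ u d → Bounded r (rich u d) (2 + u) (weight u d) (ack (suc d) 5)
  bounded-level zero          d = bounded-2
  bounded-level (suc zero)    d = bounded-3
  bounded-level (suc (suc u)) d = bounded-ack r (2 + u) d 5

  overhead : ℕ → ℕ → ℕ
  overhead u d = suc (rich u d) * (weight u d * 4 + 1)

  coeff : ℕ → ℕ → ℕ
  coeff zero          d = r
  coeff (suc zero)    d = r
  coeff (suc (suc u)) d = coeff u d * overhead u d

  1≤coeff : 1 ≤ r → ∀ s d → 1 ≤ coeff s d
  1≤coeff 1≤r zero          d = 1≤r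
  1≤coeff 1≤r (suc zero)    d = 1≤r
  1≤coeff 1≤r (suc (suc u)) d = *-mono-≤ (1≤coeff 1≤r u d) (*-mono-≤ (s≤s (z≤n {rich u d})) (m≤n+m 1 (weight u d * 4)))

  coeff-bound : 1 ≤ r → ∀ s d n → 4 * n ≤ ack (suc d) 5 → Sequences.LengthBound (Data.Fin._≟_ {n}) r s (coeff s d) n
  coeff-bound 1≤r zero          d n h = Sequences.length-bound-0 Data.Fin._≟_ r n
  coeff-bound 1≤r (suc zero)    d n h = Sequences.length-bound-1 Data.Fin._≟_ r n
  coeff-bound 1≤r (suc (suc u)) d n h = Sequences.length-bound-step Data.Fin._≟_ (1≤coeff 1≤r u d)
    (bounded-mono ≤-refl ≤-refl h (bounded-level u d)) (coeff-bound 1≤r u d n h)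

  -- The outermost step takes its own k and w: for s = 4 and s = 5 those with constant weight, while
  -- `coeff` uses the general bounds for the inner steps.
  formation-free≤ : 1 ≤ r → ∀ {u k w} d n → 4 * n ≤ ack (suc d) 5 → Bounded r k (2 + u) w (ack (suc d) 5) →
    ∀ (S : List (Fin n)) → FormationFree r (2 + u) S → length S ≤ coeff u d * (suc k * (w * 4 + 1)) * n
  formation-free≤ 1≤r {u} {k} {w} d n h b S ff = formation-free-length {c = coeff u d * (suc k * (w * 4 + 1))} S
    (Sequences.length-bound-step Data.Fin._≟_ (1≤coeff 1≤r u d) (bounded-mono ≤-refl ≤-refl h b) (coeff-bound 1≤r u d n h)) ff

  below-affine : ∀ {e f} → Below e f → Below e (λ d → f d * 4 + 1)
  below-affine {f = f} b = below-≤ (λ d → ≤-reflexive (+-comm (f d * 4) 1)) (below-suc (below-* b (below-const 4)))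

  weight-below : ∀ u {e} → 1 ≤ e → Below e (weight u)
  weight-below zero          h = below-const r
  weight-below (suc zero)    h = below-const r
  weight-below (suc (suc u)) h = below-weaken h (below-* (below-* (below-const r) (below-8^ (2 + u))) (below-const (5 ^ (2 + u))))

  coeff-below : ∀ u → Below ⌊ u /2⌋ (coeff (2 + u))
  coeff-below zero = below-* (below-const r) (below-* (below-suc (rich-below 0)) (below-affine (below-const r)))
  coeff-below (suc zero) = below-* (below-const r) (below-* (below-suc (rich-below 1)) (below-affine (below-const r)))
  coeff-below (suc (suc u)) = below-* (below-weaken (n≤1+n _) (coeff-below u))
    (below-* (below-suc (rich-below (2 + u))) (below-affine (weight-below (2 + u) (s≤s z≤n))))

  OddBound EvenBound : ℕ → ℕ → ℕ → Set
  OddBound  s t C = ∀ n → 7 ≤ n → ∀ (S : List (Fin n)) → FormationFree r s S →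
    length S ^ (t !) ≤ n ^ (t !) * 2 ^ (alpha n ^ t + C * alpha n ^ (t ∸ 1))
  EvenBound s t C = ∀ n → 7 ≤ n → ∀ (S : List (Fin n)) → FormationFree r s S →
    length S ^ (t !) ≤ n ^ (t !) * (alpha n ^ (alpha n ^ t) * 2 ^ (C * alpha n ^ t))

  odd-from : ∀ {s t : ℕ} {c : ℕ → ℕ} → (∀ d n → 4 * n ≤ ack (suc d) 5 → ∀ (S : List (Fin n)) → FormationFree r s S → length S ≤ c d * n) →
    ∃[ C ] (∀ d L n → L ≤ c d * n → L ^ (t !) ≤ n ^ (t !) * 2 ^ ((2 + d) ^ t + C * (2 + d) ^ (t ∸ 1))) → ∃[ C ] OddBound s t C
  odd-from {s} {t} {c} hc (C , g) = C , bound
    where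
    bound : OddBound s t C
    bound n 7≤n S ff with alpha n | level-of-alpha n 7≤n
    ... | _ | d , refl , h = g d (length S) n (hc d n h S ff)

  even-from : ∀ {s t : ℕ} {c : ℕ → ℕ} → (∀ d n → 4 * n ≤ ack (suc d) 5 → ∀ (S : List (Fin n)) → FormationFree r s S → length S ≤ c d * n) →
    ∃[ C ] (∀ d L n → L ≤ c d * n → L ^ (t !) ≤ n ^ (t !) * ((2 + d) ^ ((2 + d) ^ t) * 2 ^ (C * (2 + d) ^ t))) → ∃[ C ] EvenBound s t C
  even-from {s} {t} {c} hc (C , g) = C , bound
    where
    bound : EvenBound s t C
    bound n 7≤n S ff with alpha n | level-of-alpha n 7≤n
    ... | _ | d , refl , h = g d (length S) n (hc d n h S ff)

  pull-out : ∀ c k p w → c * (k * p * w) ≡ c * k * w * p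
  pull-out = solve-∀

  odd-bound-5 : 1 ≤ r → ∃[ K ] ∃[ W ] (∀ d → Bounded r (K * (rich 3 d + 2 ^ d)) 5 W (ack (suc d) 5)) →
    ∃[ K₃ ] (∀ d → rich 3 d ≤ K₃ * 2 ^ d) → ∃[ C ] OddBound 5 1 C
  odd-bound-5 1≤r (K , W , b) (K₃ , h₃) = odd-from {5} {1} {c} (λ d n h → formation-free≤ 1≤r d n h (b d))
    (odd-growth 0 {c} {f} {λ d → 2 ^ d} c≤
      (below-* (below-* (coeff-below 1) (below-const (K * (K₃ + 1) + 1))) (below-const (W * 4 + 1)))
      (0 , λ d → ≤-reflexive (trans (*-identityʳ (2 ^ d)) (cong (2 ^_) (trans (sym (+-identityʳ d)) (sym (*-identityʳ (d + 0))))))))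
    where
    c f : ℕ → ℕ
    c d = coeff 3 d * (suc (K * (rich 3 d + 2 ^ d)) * (W * 4 + 1))
    f d = coeff 3 d * (K * (K₃ + 1) + 1) * (W * 4 + 1)
    lem : ∀ K K₃ p → p + K * (K₃ * p + p) ≡ (K * (K₃ + 1) + 1) * p
    lem = solve-∀
    mult : ∀ d → suc (K * (rich 3 d + 2 ^ d)) ≤ (K * (K₃ + 1) + 1) * 2 ^ d
    mult d = ≤-trans (+-mono-≤ (m^n>0 2 d) (*-monoʳ-≤ K (+-monoˡ-≤ (2 ^ d) (h₃ d)))) (≤-reflexive (lem K K₃ (2 ^ d)))
    c≤ : ∀ d → c d ≤ f d * 2 ^ d
    c≤ d = ≤-trans (*-monoʳ-≤ (coeff 3 d) (*-monoˡ-≤ (W * 4 + 1) (mult d)))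
      (≤-reflexive (pull-out (coeff 3 d) (K * (K₃ + 1) + 1) (2 ^ d) (W * 4 + 1)))

  even-bound-4 : 1 ≤ r → ∃[ K ] ∃[ W ] (∀ d → Bounded r (K * suc d) 4 W (ack (suc d) 5)) → ∃[ C ] EvenBound 4 0 C
  even-bound-4 1≤r (K , W , b) = even-from {4} {0} {c} (λ d n h → formation-free≤ 1≤r d n h (b d))
    (even-growth 0 0 {c} {f} {λ d → 2 + d} c≤
      (below-* (below-* (coeff-below 0) (below-const (K + 1))) (below-const (W * 4 + 1)))
      (0 , λ d → ≤-reflexive (cong (_* 1) (sym (*-identityˡ (2 + d))))))
    where
    c f : ℕ → ℕ
    c d = coeff 2 d * (suc (K * suc d) * (W * 4 + 1))
    f d = coeff 2 d * (K + 1) * (W * 4 + 1)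
    lem : ∀ K d → suc (K * suc d) + (K + suc d) ≡ (K + 1) * (2 + d)
    lem = solve-∀
    mult : ∀ d → suc (K * suc d) ≤ (K + 1) * (2 + d)
    mult d = ≤-trans (m≤m+n _ (K + suc d)) (≤-reflexive (lem K d))
    c≤ : ∀ d → c d ≤ f d * (2 + d)
    c≤ d = ≤-trans (*-monoʳ-≤ (coeff 2 d) (*-monoˡ-≤ (W * 4 + 1) (mult d))) (≤-reflexive (pull-out (coeff 2 d) (K + 1) (2 + d) (W * 4 + 1)))

  rest : ℕ → ℕ → ℕ
  rest u d = coeff u d * (2 * (weight u d * 4 + 1))

  coeff≤rest : ∀ u d → coeff (2 + u) d ≤ rest u d * rich u d
  coeff≤rest u d = ≤-trans (*-monoʳ-≤ (coeff u d) (*-monoˡ-≤ (weight u d * 4 + 1) (suc≤2* (1≤rich u d)))) (≤-reflexive (lem (coeff u d) (rich u d) (weight u d * 4 + 1)))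
    where
    lem : ∀ c k w → c * (2 * k * w) ≡ c * (2 * w) * k
    lem = solve-∀

  rest-below : ∀ v {t} → ⌊ v /2⌋ ≡ suc t → Below (suc t) (rest (2 + v))
  rest-below v {t} eq = below-* (subst (λ e → Below e (coeff (2 + v))) eq (coeff-below v))
    (below-* (below-const 2) (below-affine (weight-below (2 + v) (s≤s z≤n))))

  odd-bound : 1 ≤ r → ∀ i → ∃[ C ] OddBound (5 + double i) (suc i) C
  odd-bound 1≤r zero    = odd-bound-5 1≤r (bounded-5 r) rich-3≤
  odd-bound 1≤r (suc i) = odd-from {7 + double i} {2 + i} {coeff (7 + double i)}
    (λ d n h → formation-free≤ 1≤r {5 + double i} {rich (5 + double i) d} {weight (5 + double i) d} d n h (bounded-level (5 + double i) d))
    (odd-growth (suc i) {coeff (7 + double i)} {rest (5 + double i)} {rich (5 + double i)} (coeff≤rest (5 + double i))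
      (rest-below (3 + double i) (cong suc (⌊1+double/2⌋ i))) (rich-odd-bound (suc i)))

  even-bound : 1 ≤ r → ∀ i → ∃[ C ] EvenBound (4 + double i) i C
  even-bound 1≤r zero    = even-bound-4 1≤r (bounded-4 r 1≤r)
  even-bound 1≤r (suc i) = even-from {6 + double i} {1 + i} {coeff (6 + double i)}
    (λ d n h → formation-free≤ 1≤r {4 + double i} {rich (4 + double i) d} {weight (4 + double i) d} d n h (bounded-level (4 + double i) d))
    (even-growth (suc i) (proj₁ rich-even-bound) {coeff (6 + double i)} {rest (4 + double i)} {rich (4 + double i)} (coeff≤rest (4 + double i))
      (rest-below (2 + double i) (cong suc (⌊double/2⌋ i))) (proj₂ rich-even-bound i))

parity : ∀ s → 4 ≤ s → ∃[ i ] (s ≡ 4 + double i ⊎ s ≡ 5 + double i)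
parity (suc (suc (suc (suc s)))) _ with half s
  where
  half : ∀ s → ∃[ i ] (s ≡ double i ⊎ s ≡ suc (double i))
  half zero          = 0 , inj₁ refl
  half (suc zero)    = 0 , inj₂ refl
  half (suc (suc s)) with half s
  ... | i , inj₁ e = suc i , inj₁ (cong (2 +_) e)
  ... | i , inj₂ e = suc i , inj₂ (cong (2 +_) e)
... | i , inj₁ e = i , inj₁ (cong (4 +_) e)
... | i , inj₂ e = i , inj₂ (cong (4 +_) e)
parity (suc (suc (suc zero))) (s≤s (s≤s (s≤s ())))
parity (suc (suc zero)) (s≤s (s≤s ()))
parity (suc zero) (s≤s ())

double%2 : ∀ i → double i % 2 ≡ 0
double%2 zero    = refl
double%2 (suc i) = double%2 i

1+double%2 : ∀ i → suc (double i) % 2 ≡ 1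
1+double%2 zero    = refl
1+double%2 (suc i) = 1+double%2 i

theorem1p3 : ∀ (r s : ℕ) → 1 ≤ r → 4 ≤ s →
    ∃[ C ] ∃[ N ] ∀ (n : ℕ) → N ≤ n → ∀ (S : List (Fin n)) → FormationFree r s S →
    ((s % 2 ≡ 1 →
    length S ^ (⌊ (s ∸ 3) /2⌋ !) ≤
    n ^ (⌊ (s ∸ 3) /2⌋ !) * 2 ^ (alpha n ^ ⌊ (s ∸ 3) /2⌋ + C * alpha n ^ (⌊ (s ∸ 3) /2⌋ ∸ 1)))
    × (s % 2 ≡ 0 →
    length S ^ (⌊ (s ∸ 3) /2⌋ !) ≤
    n ^ (⌊ (s ∸ 3) /2⌋ !) * (alpha n ^ (alpha n ^ ⌊ (s ∸ 3) /2⌋) * 2 ^ (C * alpha n ^ ⌊ (s ∸ 3) /2⌋))))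
theorem1p3 r s 1≤r 4≤s with parity s 4≤s
... | i , inj₁ refl with even-bound r 1≤r i
...   | C , bound = C , 7 , λ n 7≤n S ff →
  (λ odd → ⊥-elim (0≢1+n (trans (sym (double%2 i)) odd))) ,
  (λ _ → subst (λ t → length S ^ (t !) ≤ n ^ (t !) * (alpha n ^ (alpha n ^ t) * 2 ^ (C * alpha n ^ t)))
    (sym (⌊1+double/2⌋ i)) (bound n 7≤n S ff))
theorem1p3 r s 1≤r 4≤s | i , inj₂ refl with odd-bound r 1≤r i
...   | C , bound = C , 7 , λ n 7≤n S ff →
  (λ _ → subst (λ t → length S ^ (t !) ≤ n ^ (t !) * 2 ^ (alpha n ^ t + C * alpha n ^ (t ∸ 1)))
    (cong suc (sym (⌊double/2⌋ i))) (bound n 7≤n S ff)) ,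
  (λ even → ⊥-elim (1+n≢0 (trans (sym (1+double%2 i)) even)))
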